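{- Let $q$ be an odd prime power, let $d \geq 1$ and $n \geq 2$ be integers, and let $M_n(\mathbb{F}_q)$ denote the set of $n \times n$ matrices with entries in the finite field $\mathbb{F}_q$. Let $\mathcal{A}_1,\dots,\mathcal{A}_d,\mathcal{B}_1,\dots,\mathcal{B}_d,\mathcal{E},\mathcal{F} \subset M_n(\mathbb{F}_q)$, and let $N$ be the number of tuples $(A_1,\dots,A_d,B_1,\dots,B_d,E,F)$ with $A_i \in \mathcal{A}_i$, $B_i \in \mathcal{B}_i$ ($1 \le i \le d$), $E \in \mathcal{E}$, $F \in \mathcal{F}$ satisfying \[ A_1B_1 + A_2B_2 + \dots + A_dB_d = E + F. \] Then \[ \left| N - \frac{|\mathcal{E}||\mathcal{F}|\prod_{i=1}^d |\mathcal{A}_i||\mathcal{B}_i|}{q^{n^2}} \right| \ll q^{dn^2 - (d-1)n/2 - 1/2} \sqrt{|\mathcal{E}||\mathcal{F}|\prod_{i=1}^d|\mathcal{A}_i||\mathcal{B}_i|}. \]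
   Context: The notation $X \ll Y$ means $X \le C\,Y$ for some positive constant $C$ depending only on $d$ and $n$ (not on $q$ or on the sets). -}

module Defs where

open import Algebra.Bundles using (CommutativeRing)
open import Data.Fin.Base using (Fin)
import Data.Fin.Properties as Fin
open import Data.Integer.Base using (+_)
open import Data.List.Base using (List; []; _∷_; length; filter; cartesianProduct; cartesianProductWith)
import Data.List.Relation.Unary.Unique.Setoid as UniqueSetoid
open import Data.Nat.Base as ℕ using (ℕ; zero; suc; NonZero)
open import Data.Nat.Divisibility using (_∤_)
open import Data.Nat.Primality using (Prime; prime⇒nonZero)
import Data.Nat.Properties as ℕ
open import Data.Product.Base using (_×_; _,_; ∃; ∃₂)
open import Data.Rational.Base as ℚ using (ℚ)
open import Data.Vec.Functional as Vector using (Vector)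
import Data.Vec.Functional.Relation.Binary.Equality.Setoid as ≋
import Data.Vec.Functional.Relation.Binary.Pointwise.Properties as Pointwise
open import Function.Bundles using (Inverse)
open import Function.Properties.Inverse using (Inverse⇒Injection)
open import Level using (Level; _⊔_) renaming (suc to lsuc)
open import Relation.Binary.Bundles using (Setoid)
open import Relation.Binary.Definitions using (Decidable)
open import Relation.Binary.PropositionalEquality as ≡ using (_≡_)
open import Relation.Nullary.Decidable using (via-injection)
import Relation.Unary as Unary

OddPrimePower : ℕ → Set
OddPrimePower q = (∃₂ λ p k → Prime p × 1 ℕ.≤ k × q ≡ p ℕ.^ k) × 2 ∤ q

primePower^m≢0 : ∀ {q} → OddPrimePower q → ∀ m → NonZero (q ℕ.^ m)
primePower^m≢0 {q} ((p , k , p-prime , _ , ≡.refl) , _) m = ℕ.m^n≢0 q m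
  where instance
    p≢0 : NonZero p
    p≢0 = prime⇒nonZero p-prime
    q≢0 : NonZero (p ℕ.^ k)
    q≢0 = ℕ.m^n≢0 p k

-- A field with exactly q elements, where elements are counted up to ≈.
record FiniteField (c ℓ : Level) (q : ℕ) : Set (lsuc (c ⊔ ℓ)) where
  field
    commutativeRing : CommutativeRing c ℓ

  open CommutativeRing commutativeRing public

  field
    1≉0         : 1# ≉ 0#
    inverse     : ∀ x → x ≉ 0# → ∃ λ y → x * y ≈ 1#
    enumeration : Inverse setoid (≡.setoid (Fin q))

  _≟_ : Decidable _≈_
  _≟_ = via-injection (Inverse⇒Injection enumeration) Fin._≟_

-- Equality in a finite structure is decidable, so every subset of it is
-- classically the range of a list without repetitions; its cardinality is
-- then the length of the list.
record FiniteSubset {a ℓ} (S : Setoid a ℓ) : Set (a ⊔ ℓ) where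
  field
    elements : List (Setoid.Carrier S)
    unique   : UniqueSetoid.Unique S elements

open FiniteSubset public using (elements)

∣_∣ : ∀ {a ℓ} {S : Setoid a ℓ} → FiniteSubset S → ℕ
∣ X ∣ = length (elements X)

∏ : ∀ {d} → Vector ℕ d → ℕ
∏ = Vector.foldr ℕ._*_ 1

-- All (x₁ , … , x_d) with xᵢ in the i-th list.
choices : ∀ {a} {A : Set a} {d} → Vector (List A) d → List (Vector A d)
choices {d = zero}  Xs = Vector.[] ∷ []
choices {d = suc d} Xs =
  cartesianProductWith Vector._∷_ (Vector.head Xs) (choices (Vector.tail Xs))

module Matrices {c ℓ} {q : ℕ} (F : FiniteField c ℓ q) (n : ℕ) where
  open FiniteField F

  matrixSetoid : Setoid c ℓ
  matrixSetoid = ≋.≋-setoid (≋.≋-setoid setoid n) n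

  open Setoid matrixSetoid public using ()
    renaming (Carrier to Matrix; _≈_ to _≈ᴹ_)

  _≟ᴹ_ : Decidable _≈ᴹ_
  _≟ᴹ_ = Pointwise.decidable (Pointwise.decidable _≟_)

  infixl 6 _+ᴹ_
  infixl 7 _*ᴹ_

  0ᴹ : Matrix
  0ᴹ i j = 0#

  _+ᴹ_ : Matrix → Matrix → Matrix
  (A +ᴹ B) i j = A i j + B i j

  _*ᴹ_ : Matrix → Matrix → Matrix
  (A *ᴹ B) i j = Vector.foldr _+_ 0# (λ k → A i k * B k j)

  ∑ᴹ : ∀ {d} → Vector Matrix d → Matrix
  ∑ᴹ = Vector.foldr _+ᴹ_ 0ᴹ

  MatrixSet : Set (c ⊔ ℓ)
  MatrixSet = FiniteSubset matrixSetoid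

  Tuple : ℕ → Set c
  Tuple d = Vector Matrix d × Vector Matrix d × Matrix × Matrix

  IsSolution : ∀ {d} → Tuple d → Set ℓ
  IsSolution (A , B , E , F) = ∑ᴹ (λ i → A i *ᴹ B i) ≈ᴹ E +ᴹ F

  isSolution? : ∀ {d} → Unary.Decidable (IsSolution {d})
  isSolution? (A , B , E , F) = ∑ᴹ (λ i → A i *ᴹ B i) ≟ᴹ (E +ᴹ F)

  tuples : ∀ {d} (𝒜 ℬ : Vector MatrixSet d) (ℰ ℱ : MatrixSet) → List (Tuple d)
  tuples 𝒜 ℬ ℰ ℱ =
    cartesianProduct (choices (λ i → elements (𝒜 i)))
      (cartesianProduct (choices (λ i → elements (ℬ i)))
        (cartesianProduct (elements ℰ) (elements ℱ)))

  solutionCount : ∀ {d} (𝒜 ℬ : Vector MatrixSet d) (ℰ ℱ : MatrixSet) → ℕ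
  solutionCount 𝒜 ℬ ℰ ℱ = length (filter isSolution? (tuples 𝒜 ℬ ℰ ℱ))

  sizeProduct : ∀ {d} (𝒜 ℬ : Vector MatrixSet d) (ℰ ℱ : MatrixSet) → ℕ
  sizeProduct 𝒜 ℬ ℰ ℱ = ∣ ℰ ∣ ℕ.* ∣ ℱ ∣ ℕ.* ∏ (λ i → ∣ 𝒜 i ∣ ℕ.* ∣ ℬ i ∣)

ℕ→ℚ : ℕ → ℚ
ℕ→ℚ m = + m ℚ./ 1

-- The real inequality x ≤ C √y, for rationals x, C ≥ 0 and a natural number y.
_≤_·√_ : ℚ → ℚ → ℕ → Set
x ≤ C ·√ y = x ℚ.* x ℚ.≤ C ℚ.* C ℚ.* ℕ→ℚ y

infix 4 _≤_·√_

-- Twice the exponent d n² − (d−1) n/2 − 1/2, so that q to the latter is the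
-- square root of q ^ doubledExponent d n.  For d, n ≥ 1 neither truncated
-- subtraction truncates, as 2dn² ≥ dn ≥ (d−1)n + 1.
doubledExponent : ℕ → ℕ → ℕ
doubledExponent d n = 2 ℕ.* d ℕ.* (n ℕ.* n) ℕ.∸ ((d ℕ.∸ 1) ℕ.* n ℕ.+ 1)

{-# OPTIONS --safe #-}
module Submission where

-- Join s = (A , E) to t = (B , F) when Σ Aᵢ Bᵢ = E + F.  Two vertices (A , E)
-- and (A′ , E′) have #{B : Σ (Aᵢ − A′ᵢ) Bᵢ = E − E′} common neighbours, which
-- is the expected q ^ (dn² − n²) unless the n × dn matrix A − A′ has dependent
-- rows.  There are at most n q ^ (n−1) q ^ (dn(n−1)) such matrices A − A′, and
-- for each of them the counts over all E′ sum to q ^ (dn²).  Hence the variance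
-- over all t of the number of neighbours in 𝒜 × ℰ is at most
-- n q ^ doubledExponent d n times |𝒜| |ℰ|, and Cauchy–Schwarz over ℬ × ℱ gives
-- the theorem.

open import Defs
open import Algebra.Bundles using (CommutativeMonoid)
import Algebra.Properties.Group
import Algebra.Properties.Ring
import Algebra.Properties.Semiring.Sum
open import Data.Bool.Base using (if_then_else_)
open import Data.Fin.Base using (Fin; zero; suc)
import Data.Fin.Properties as Fin
import Data.Integer.Base as ℤ
import Data.Integer.Properties as ℤ
open import Data.List.Base using (List; []; _∷_; _++_; length; map; filter; allFin; cartesianProduct; cartesianProductWith)
open import Data.List.Properties using (map-++; length-++; length-map; length-tabulate; map-tabulate)
open import Data.List.Relation.Unary.All using (All; []; _∷_)
open import Data.List.Relation.Unary.AllPairs using ([]; _∷_)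
import Data.List.Relation.Unary.Unique.Setoid as UniqueSetoid
open import Data.Nat.Base as ℕ using (ℕ; zero; suc; z≤n; _^_)
open import Data.Nat.ListAction.Properties using (sum-++)
import Data.Nat.Properties as ℕ
open import Data.Nat.Tactic.RingSolver using (solve-∀)
open import Data.Product.Base using (_×_; _,_; proj₁; proj₂; ∃; ∃₂)
open import Data.Product.Relation.Binary.Pointwise.NonDependent using (×-decSetoid)
open import Data.Rational.Base as ℚ using (ℚ)
import Data.Rational.Properties as ℚ
open import Data.Rational.Unnormalised.Base as ℚᵘ using (mkℚᵘ; _≃_; *≡*; *≤*)
import Data.Rational.Unnormalised.Properties as ℚᵘ
open import Data.Sum.Base using (_⊎_; inj₁; inj₂)
open import Data.Vec.Functional as Vector using (Vector)
import Data.Vec.Functional.Relation.Binary.Pointwise.Properties as Pointwise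
open import Function.Base using (_∘_; id)
open import Function.Bundles using (Inverse)
open import Level using (Level; 0ℓ; _⊔_)
open import Relation.Binary.Bundles using (DecSetoid)
open import Relation.Binary.PropositionalEquality as ≡ using (_≡_)
open import Relation.Nullary using (Dec; yes; no; does; ¬_; contradiction)
import Relation.Unary as Unary

-- The count of common neighbours has no useful pointwise bound when A - A′ has dependent rows: for
-- A = A′ and E = E′ every B is counted. Only its sum is controlled, so in the error term the given
-- set of pairs (A′ , E′) is enlarged to all pairs; all terms being nonnegative, this is harmless.
-- Rank never appears: independence is witnessed by a dual family, which is also the right inverse
-- that solves for B, and dependence by a positive count of coefficient vectors. To stay within ℕ,
-- averages are multiplied by the number q ^ (n²) of matrices and differences are absolute ones;
-- rationals enter only when this factor is divided out. The estimate yields the constant √n, which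
-- is rounded up to n because C is rational.

module _ where
  open import Data.Nat.Base using (_+_; _*_; _≤_; ∣_-_∣)
  open import Data.Nat.ListAction using (sum)
  open import Data.Nat.Properties hiding (_≟_)
  open import Relation.Binary.PropositionalEquality using (refl; sym; trans; cong; cong₂; module ≡-Reasoning)

  private variable
    a b ℓ ℓ′ p : Level
    A B C : Set a

  -- Indicators and sums over lists

  𝟙 : {P : Set p} → Dec P → ℕ
  𝟙 P? = if does P? then 1 else 0

  𝟙-true : {P : Set p} (P? : Dec P) → P → 𝟙 P? ≡ 1
  𝟙-true (yes _) _ = refl
  𝟙-true (no ¬p) p = contradiction p ¬p

  𝟙-false : {P : Set p} (P? : Dec P) → ¬ P → 𝟙 P? ≡ 0
  𝟙-false (yes p) ¬p = contradiction p ¬p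
  𝟙-false (no _)  _  = refl

  𝟙-cong : {P : Set a} {Q : Set b} (P? : Dec P) (Q? : Dec Q) →
           (P → Q) → (Q → P) → 𝟙 P? ≡ 𝟙 Q?
  𝟙-cong (yes p) Q? f g = sym (𝟙-true Q? (f p))
  𝟙-cong (no ¬p) Q? f g = sym (𝟙-false Q? (¬p ∘ g))

  𝟙-mono : {P : Set a} {Q : Set b} (P? : Dec P) (Q? : Dec Q) → (P → Q) → 𝟙 P? ≤ 𝟙 Q?
  𝟙-mono (yes p) Q? f = ≤-reflexive (sym (𝟙-true Q? (f p)))
  𝟙-mono (no _)  Q? f = z≤n

  𝟙-× : {P : Set a} {Q : Set b} {R : Set p} (P? : Dec P) (Q? : Dec Q) (R? : Dec R) →
        (P → Q × R) → (Q → R → P) → 𝟙 P? ≡ 𝟙 Q? * 𝟙 R?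
  𝟙-× P? (yes q) (yes r) f g = 𝟙-true P? (g q r)
  𝟙-× P? (yes q) (no ¬r) f g = 𝟙-false P? (¬r ∘ proj₂ ∘ f)
  𝟙-× P? (no ¬q) R?      f g = 𝟙-false P? (¬q ∘ proj₁ ∘ f)

  ∑ : List A → (A → ℕ) → ℕ
  ∑ xs f = sum (map f xs)

  infix 5 ∑
  syntax ∑ xs (λ x → e) = ∑[ x ∈ xs ] e

  ∑-cong : (xs : List A) {f g : A → ℕ} → (∀ x → f x ≡ g x) → ∑ xs f ≡ ∑ xs g
  ∑-cong []       f≗g = refl
  ∑-cong (x ∷ xs) f≗g = cong₂ _+_ (f≗g x) (∑-cong xs f≗g)

  ∑-mono-≤ : (xs : List A) {f g : A → ℕ} → (∀ x → f x ≤ g x) → ∑ xs f ≤ ∑ xs g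
  ∑-mono-≤ []       f≤g = z≤n
  ∑-mono-≤ (x ∷ xs) f≤g = +-mono-≤ (f≤g x) (∑-mono-≤ xs f≤g)

  ∑-distrib-+ : (xs : List A) (f g : A → ℕ) → ∑[ x ∈ xs ] (f x + g x) ≡ ∑ xs f + ∑ xs g
  ∑-distrib-+ []       f g = refl
  ∑-distrib-+ (x ∷ xs) f g = trans (cong (f x + g x +_) (∑-distrib-+ xs f g))
                                   (lemma (f x) (g x) (∑ xs f) (∑ xs g))
    where
    lemma : ∀ s t u v → s + t + (u + v) ≡ s + u + (t + v)
    lemma = solve-∀

  *-distribˡ-∑ : ∀ c (xs : List A) (f : A → ℕ) → c * ∑ xs f ≡ ∑[ x ∈ xs ] (c * f x)
  *-distribˡ-∑ c []       f = *-zeroʳ c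
  *-distribˡ-∑ c (x ∷ xs) f = trans (*-distribˡ-+ c (f x) _) (cong (c * f x +_) (*-distribˡ-∑ c xs f))

  *-distribʳ-∑ : ∀ c (xs : List A) (f : A → ℕ) → ∑ xs f * c ≡ ∑[ x ∈ xs ] (f x * c)
  *-distribʳ-∑ c xs f = trans (*-comm (∑ xs f) c)
    (trans (*-distribˡ-∑ c xs f) (∑-cong xs λ x → *-comm c (f x)))

  ∑-const : (xs : List A) (c : ℕ) → ∑[ _ ∈ xs ] c ≡ length xs * c
  ∑-const []       c = refl
  ∑-const (x ∷ xs) c = cong (c +_) (∑-const xs c)

  ∑-comm : (xs : List A) (ys : List B) (f : A → B → ℕ) →
           ∑[ x ∈ xs ] ∑[ y ∈ ys ] f x y ≡ ∑[ y ∈ ys ] ∑[ x ∈ xs ] f x y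
  ∑-comm []       ys f = sym (trans (∑-const ys 0) (*-zeroʳ (length ys)))
  ∑-comm (x ∷ xs) ys f = trans (cong (∑ ys (f x) +_) (∑-comm xs ys f))
                               (sym (∑-distrib-+ ys (f x) _))

  ∑-++ : (xs ys : List A) (f : A → ℕ) → ∑ (xs ++ ys) f ≡ ∑ xs f + ∑ ys f
  ∑-++ xs ys f = trans (cong sum (map-++ f xs ys)) (sum-++ (map f xs) _)

  ∑-map : (h : A → B) (xs : List A) (f : B → ℕ) → ∑ (map h xs) f ≡ ∑ xs (f ∘ h)
  ∑-map h []       f = refl
  ∑-map h (x ∷ xs) f = cong (f (h x) +_) (∑-map h xs f)

  ∑-cartesianProductWith : (h : A → B → C) (xs : List A) (ys : List B) (f : C → ℕ) →
    ∑ (cartesianProductWith h xs ys) f ≡ ∑[ x ∈ xs ] ∑[ y ∈ ys ] f (h x y)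
  ∑-cartesianProductWith h []       ys f = refl
  ∑-cartesianProductWith h (x ∷ xs) ys f = trans (∑-++ (map (h x) ys) _ f)
    (cong₂ _+_ (∑-map (h x) ys f) (∑-cartesianProductWith h xs ys f))

  length-filter : {P : A → Set p} (P? : Unary.Decidable P) (xs : List A) →
                  length (filter P? xs) ≡ ∑[ x ∈ xs ] 𝟙 (P? x)
  length-filter P? []       = refl
  length-filter P? (x ∷ xs) with P? x
  ... | yes _ = cong suc (length-filter P? xs)
  ... | no  _ = length-filter P? xs

  length-∑ : (xs : List A) → length xs ≡ ∑[ _ ∈ xs ] 1
  length-∑ xs = sym (trans (∑-const xs 1) (*-identityʳ _))

  length-cartesianProductWith : (h : A → B → C) (xs : List A) (ys : List B) →
    length (cartesianProductWith h xs ys) ≡ length xs * length ys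
  length-cartesianProductWith h []       ys = refl
  length-cartesianProductWith h (x ∷ xs) ys = trans (length-++ (map (h x) ys))
    (cong₂ _+_ (length-map (h x) ys) (length-cartesianProductWith h xs ys))

  length-choices : ∀ {d} (Xs : Vector (List A) d) → length (choices Xs) ≡ ∏ (λ i → length (Xs i))
  length-choices {d = zero}  Xs = refl
  length-choices {d = suc d} Xs =
    trans (length-cartesianProductWith Vector._∷_ (Xs zero) (choices (Vector.tail Xs)))
          (cong (length (Xs zero) *_) (length-choices (Vector.tail Xs)))

  ∏-const : ∀ d c → ∏ {d} (λ _ → c) ≡ c ^ d
  ∏-const zero    c = refl
  ∏-const (suc d) c = cong (c *_) (∏-const d c)

  ∏-cong : ∀ {d} {f g : Vector ℕ d} → (∀ i → f i ≡ g i) → ∏ f ≡ ∏ g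
  ∏-cong {zero}  f≗g = refl
  ∏-cong {suc d} f≗g = cong₂ _*_ (f≗g zero) (∏-cong (f≗g ∘ suc))

  ∏-distrib-* : ∀ {d} (f g : Vector ℕ d) → ∏ (λ i → f i * g i) ≡ ∏ f * ∏ g
  ∏-distrib-* {zero}  f g = refl
  ∏-distrib-* {suc d} f g = trans (cong (f zero * g zero *_) (∏-distrib-* (f ∘ suc) (g ∘ suc)))
                                  (lemma (f zero) (g zero) _ _)
    where
    lemma : ∀ s t u v → s * t * (u * v) ≡ s * u * (t * v)
    lemma = solve-∀

  ∏-≤1 : ∀ {d} {f : Vector ℕ d} → (∀ i → f i ≤ 1) → ∏ f ≤ 1
  ∏-≤1 {zero}  f≤1 = ≤-refl
  ∏-≤1 {suc d} f≤1 = *-mono-≤ (f≤1 zero) (∏-≤1 (f≤1 ∘ suc))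

  -- Multiplicities and enumerations

  module _ (S : DecSetoid a ℓ) where
    open DecSetoid S using (Carrier; _≈_; _≟_)

    multiplicity : Carrier → List Carrier → ℕ
    multiplicity x xs = ∑[ y ∈ xs ] 𝟙 (x ≟ y)

    -- Counting multiplicities up to `≈`, in place of membership together with uniqueness, makes the
    -- condition an equation between sums. It passes to products and vectors by factoring the sum.
    record Enumeration : Set (a ⊔ ℓ) where
      field
        list : List Carrier
        once : ∀ x → multiplicity x list ≡ 1

    Respects≈ : (Carrier → ℕ) → Set (a ⊔ ℓ)
    Respects≈ f = ∀ {x y} → x ≈ y → f x ≡ f y

  open Enumeration

  module _ (S : DecSetoid a ℓ) where
    open DecSetoid S using (Carrier; _≈_; _≟_; setoid) renaming (trans to ≈-trans; sym to ≈-sym; refl to ≈-refl)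

    private
      𝟙-subst : {f : Carrier → ℕ} → Respects≈ S f → ∀ x y → 𝟙 (x ≟ y) * f y ≡ 𝟙 (x ≟ y) * f x
      𝟙-subst {f} resp x y with x ≟ y
      ... | yes x≈y = cong (1 *_) (resp (≈-sym x≈y))
      ... | no  _   = refl

    ∑-select : (U : Enumeration S) {f : Carrier → ℕ} → Respects≈ S f →
               ∀ x → ∑[ y ∈ list U ] (𝟙 (x ≟ y) * f y) ≡ f x
    ∑-select U {f} resp x = begin
      ∑[ y ∈ list U ] (𝟙 (x ≟ y) * f y)  ≡⟨ ∑-cong (list U) (𝟙-subst resp x) ⟩
      ∑[ y ∈ list U ] (𝟙 (x ≟ y) * f x)  ≡⟨ *-distribʳ-∑ (f x) (list U) _ ⟨
      multiplicity S x (list U) * f x    ≡⟨ cong (_* f x) (once U x) ⟩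
      1 * f x                            ≡⟨ *-identityˡ (f x) ⟩
      f x                                ∎
      where open ≡-Reasoning

    -- Expanding f x by `∑-select` and exchanging the sums gives each y of the enumeration the
    -- weight `multiplicity S y xs`. This is how the absence of repetitions in the given sets enters
    -- the estimates.
    ∑-≤-enumeration : (U : Enumeration S) (xs : List Carrier) → (∀ x → multiplicity S x xs ≤ 1) →
                      {f : Carrier → ℕ} → Respects≈ S f → ∑ xs f ≤ ∑ (list U) f
    ∑-≤-enumeration U xs xs≤1 {f} resp = begin
      ∑ xs f                                             ≡⟨ ∑-cong xs (∑-select U resp) ⟨
      ∑[ x ∈ xs ] ∑[ y ∈ list U ] (𝟙 (x ≟ y) * f y)      ≡⟨ ∑-comm xs (list U) _ ⟩
      ∑[ y ∈ list U ] ∑[ x ∈ xs ] (𝟙 (x ≟ y) * f y)      ≡⟨ ∑-cong (list U) (λ y → *-distribʳ-∑ (f y) xs _) ⟨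
      ∑[ y ∈ list U ] ((∑[ x ∈ xs ] 𝟙 (x ≟ y)) * f y)    ≡⟨ ∑-cong (list U) (λ y → cong (_* f y)
                                                              (∑-cong xs λ x → 𝟙-cong (x ≟ y) (y ≟ x) ≈-sym ≈-sym)) ⟩
      ∑[ y ∈ list U ] (multiplicity S y xs * f y)        ≤⟨ ∑-mono-≤ (list U) (λ y → *-monoˡ-≤ (f y) (xs≤1 y)) ⟩
      ∑[ y ∈ list U ] (1 * f y)                          ≡⟨ ∑-cong (list U) (λ y → *-identityˡ (f y)) ⟩
      ∑ (list U) f                                       ∎
      where open ≤-Reasoning

    multiplicity≡0 : ∀ {x xs} → All (λ y → ¬ x ≈ y) xs → multiplicity S x xs ≡ 0
    multiplicity≡0 []                       = refl
    multiplicity≡0 {x} (_∷_ {y} x≉y x∉xs) = cong₂ _+_ (𝟙-false (x ≟ y) x≉y) (multiplicity≡0 x∉xs)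

    unique⇒multiplicity≤1 : ∀ {xs} → UniqueSetoid.Unique setoid xs → ∀ x → multiplicity S x xs ≤ 1
    unique⇒multiplicity≤1 []              x = z≤n
    unique⇒multiplicity≤1 (_∷_ {y} {ys} y∉ys uniq) x with x ≟ y
    ... | no  _   = unique⇒multiplicity≤1 uniq x
    -- After the first match x may be replaced by y, which does not occur in the tail.
    ... | yes x≈y = ≤-reflexive (cong suc (trans
      (∑-cong ys λ z → 𝟙-cong (x ≟ z) (y ≟ z) (≈-trans (≈-sym x≈y)) (≈-trans x≈y))
      (multiplicity≡0 y∉ys)))

  module _ (S : DecSetoid a ℓ) (T : DecSetoid b ℓ′) where
    private
      module S = DecSetoid S
      module T = DecSetoid T

    -- The two implications pack both inverse laws and both congruences of φ and ψ; they say that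
    -- exactly one x, namely ψ y, lies over each y.
    ∑-bijection : (U : Enumeration S) (V : Enumeration T) {φ : S.Carrier → T.Carrier} {ψ : T.Carrier → S.Carrier} →
      (∀ x y → φ x T.≈ y → x S.≈ ψ y) → (∀ x y → x S.≈ ψ y → φ x T.≈ y) →
      {f : T.Carrier → ℕ} → Respects≈ T f → ∑ (list U) (f ∘ φ) ≡ ∑ (list V) f
    ∑-bijection U V {φ} {ψ} to from {f} resp = begin
      ∑ (list U) (f ∘ φ)                                          ≡⟨ ∑-cong (list U) (λ x → ∑-select T V resp (φ x)) ⟨
      ∑[ x ∈ list U ] ∑[ y ∈ list V ] (𝟙 (φ x T.≟ y) * f y)       ≡⟨ ∑-comm (list U) (list V) _ ⟩
      ∑[ y ∈ list V ] ∑[ x ∈ list U ] (𝟙 (φ x T.≟ y) * f y)       ≡⟨ ∑-cong (list V) (λ y → *-distribʳ-∑ (f y) (list U) _) ⟨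
      ∑[ y ∈ list V ] ((∑[ x ∈ list U ] 𝟙 (φ x T.≟ y)) * f y)     ≡⟨ ∑-cong (list V) (λ y → cong (_* f y) (fibre y)) ⟩
      ∑[ y ∈ list V ] (1 * f y)                                   ≡⟨ ∑-cong (list V) (λ y → *-identityˡ (f y)) ⟩
      ∑ (list V) f                                                ∎
      where
      open ≡-Reasoning
      fibre : ∀ y → ∑[ x ∈ list U ] 𝟙 (φ x T.≟ y) ≡ 1
      fibre y = trans
        (∑-cong (list U) λ x → 𝟙-cong (φ x T.≟ y) (ψ y S.≟ x) (S.sym ∘ to x y) (from x y ∘ S.sym))
        (once U (ψ y))

  multiplicity-× : (S : DecSetoid a ℓ) (T : DecSetoid b ℓ′) → ∀ x y xs ys →
    multiplicity (×-decSetoid S T) (x , y) (cartesianProduct xs ys) ≡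
    multiplicity S x xs * multiplicity T y ys
  multiplicity-× S T x y xs ys = begin
    multiplicity (×-decSetoid S T) (x , y) (cartesianProduct xs ys)
      ≡⟨ ∑-cartesianProductWith _,_ xs ys _ ⟩
    ∑[ x′ ∈ xs ] ∑[ y′ ∈ ys ] 𝟙 (ST._≟_ (x , y) (x′ , y′))
      ≡⟨ ∑-cong xs (λ x′ → ∑-cong ys λ y′ → 𝟙-× (ST._≟_ (x , y) (x′ , y′)) (x S.≟ x′) (y T.≟ y′) (λ e → e) _,_) ⟩
    ∑[ x′ ∈ xs ] ∑[ y′ ∈ ys ] (𝟙 (x S.≟ x′) * 𝟙 (y T.≟ y′))
      ≡⟨ ∑-cong xs (λ x′ → *-distribˡ-∑ (𝟙 (x S.≟ x′)) ys _) ⟨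
    ∑[ x′ ∈ xs ] (𝟙 (x S.≟ x′) * multiplicity T y ys)
      ≡⟨ *-distribʳ-∑ (multiplicity T y ys) xs _ ⟨
    multiplicity S x xs * multiplicity T y ys ∎
    where
    module S = DecSetoid S
    module T = DecSetoid T
    module ST = DecSetoid (×-decSetoid S T)
    open ≡-Reasoning

  enumeration-× : {S : DecSetoid a ℓ} {T : DecSetoid b ℓ′} →
                  Enumeration S → Enumeration T → Enumeration (×-decSetoid S T)
  enumeration-× {S = S} {T = T} U V = record
    { list = cartesianProduct (list U) (list V)
    ; once = λ (x , y) → trans (multiplicity-× S T x y (list U) (list V))
                               (cong₂ _*_ (once U x) (once V y))
    }

  multiplicity-choices : (S : DecSetoid a ℓ) → ∀ {d} (v : Vector (DecSetoid.Carrier S) d) Xs →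
    multiplicity (Pointwise.decSetoid S d) v (choices Xs) ≡ ∏ (λ i → multiplicity S (v i) (Xs i))
  multiplicity-choices S {zero}  v Xs = refl
  multiplicity-choices S {suc d} v Xs = begin
    multiplicity (Pointwise.decSetoid S (suc d)) v (choices Xs)
      ≡⟨ ∑-cartesianProductWith Vector._∷_ (Xs zero) (choices (Vector.tail Xs)) _ ⟩
    ∑[ x ∈ Xs zero ] ∑[ w ∈ choices (Vector.tail Xs) ] 𝟙 (V._≟_ v (x Vector.∷ w))
      ≡⟨ ∑-cong (Xs zero) (λ x → ∑-cong (choices (Vector.tail Xs)) λ w →
           𝟙-× (V._≟_ v (x Vector.∷ w)) (v zero S.≟ x) (V′._≟_ (Vector.tail v) w)
               (λ e → e zero , e ∘ suc) (λ { e e′ zero → e ; e e′ (suc i) → e′ i })) ⟩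
    ∑[ x ∈ Xs zero ] ∑[ w ∈ choices (Vector.tail Xs) ] (𝟙 (v zero S.≟ x) * 𝟙 (V′._≟_ (Vector.tail v) w))
      ≡⟨ ∑-cong (Xs zero) (λ x → *-distribˡ-∑ (𝟙 (v zero S.≟ x)) (choices (Vector.tail Xs)) _) ⟨
    ∑[ x ∈ Xs zero ] (𝟙 (v zero S.≟ x) * multiplicity (Pointwise.decSetoid S d) (Vector.tail v) (choices (Vector.tail Xs)))
      ≡⟨ *-distribʳ-∑ _ (Xs zero) _ ⟨
    multiplicity S (v zero) (Xs zero) * multiplicity (Pointwise.decSetoid S d) (Vector.tail v) (choices (Vector.tail Xs))
      ≡⟨ cong (multiplicity S (v zero) (Xs zero) *_) (multiplicity-choices S (Vector.tail v) (Vector.tail Xs)) ⟩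
    ∏ (λ i → multiplicity S (v i) (Xs i)) ∎
    where
    module S = DecSetoid S
    module V = DecSetoid (Pointwise.decSetoid S (suc d))
    module V′ = DecSetoid (Pointwise.decSetoid S d)
    open ≡-Reasoning

  enumeration-Vector : {S : DecSetoid a ℓ} → Enumeration S → ∀ n → Enumeration (Pointwise.decSetoid S n)
  enumeration-Vector {S = S} U n = record
    { list = choices {d = n} (λ _ → list U)
    ; once = λ v → trans (multiplicity-choices S v (λ _ → list U))
                         (trans (∏-cong (once U ∘ v)) (trans (∏-const n 1) (^-zeroˡ n)))
    }

  length-enumeration-Vector : {S : DecSetoid a ℓ} (U : Enumeration S) → ∀ n →
                              length (list (enumeration-Vector U n)) ≡ length (list U) ^ n
  length-enumeration-Vector U n = trans (length-choices {d = n} (λ _ → list U)) (∏-const n _)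

  -- The second moment method

  -- The mixed product stands on the left so that the binomial formula needs no subtraction; in
  -- terms of n ∸ m it is a polynomial identity.
  ∣-∣-square-≤ : ∀ {m n} → m ≤ n → ∣ m - n ∣ * ∣ m - n ∣ + 2 * (m * n) ≡ m * m + n * n
  ∣-∣-square-≤ {m} {n} m≤n = begin
    ∣ m - n ∣ * ∣ m - n ∣ + 2 * (m * n)      ≡⟨ cong₂ (λ k l → k * k + 2 * (m * l)) (m≤n⇒∣m-n∣≡n∸m m≤n) (sym (m∸n+n≡m m≤n)) ⟩
    k * k + 2 * (m * (k + m))                ≡⟨ lemma k m ⟩
    m * m + (k + m) * (k + m)                ≡⟨ cong (λ l → m * m + l * l) (m∸n+n≡m m≤n) ⟩
    m * m + n * n                            ∎
    where
    open ≡-Reasoning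
    k = n ℕ.∸ m
    lemma : ∀ k m → k * k + 2 * (m * (k + m)) ≡ m * m + (k + m) * (k + m)
    lemma = solve-∀

  ∣-∣-square : ∀ m n → ∣ m - n ∣ * ∣ m - n ∣ + 2 * (m * n) ≡ m * m + n * n
  ∣-∣-square m n with ≤-total m n
  ... | inj₁ m≤n = ∣-∣-square-≤ m≤n
  ... | inj₂ n≤m = trans (cong₂ (λ k l → k * k + 2 * l) (∣-∣-comm m n) (*-comm m n))
                         (trans (∣-∣-square-≤ n≤m) (+-comm (n * n) (m * m)))

  2mn≤m²+n² : ∀ m n → 2 * (m * n) ≤ m * m + n * n
  2mn≤m²+n² m n = ≤-trans (m≤n+m _ (∣ m - n ∣ * ∣ m - n ∣)) (≤-reflexive (∣-∣-square m n))

  ∣∑-∑∣≤∑∣-∣ : (xs : List A) (f g : A → ℕ) → ∣ ∑ xs f - ∑ xs g ∣ ≤ ∑[ x ∈ xs ] ∣ f x - g x ∣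
  ∣∑-∑∣≤∑∣-∣ []       f g = z≤n
  ∣∑-∑∣≤∑∣-∣ (x ∷ xs) f g = begin
    ∣ f x + F - g x + G ∣                        ≤⟨ ∣-∣-triangle (f x + F) (g x + F) (g x + G) ⟩
    ∣ f x + F - g x + F ∣ + ∣ g x + F - g x + G ∣ ≡⟨ cong₂ _+_
        (trans (cong₂ ∣_-_∣ (+-comm (f x) F) (+-comm (g x) F)) (∣m+n-m+o∣≡∣n-o∣ F (f x) (g x)))
        (∣m+n-m+o∣≡∣n-o∣ (g x) F G) ⟩
    ∣ f x - g x ∣ + ∣ F - G ∣                     ≤⟨ +-monoʳ-≤ _ (∣∑-∑∣≤∑∣-∣ xs f g) ⟩
    ∣ f x - g x ∣ + (∑[ y ∈ xs ] ∣ f y - g y ∣)   ∎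
    where
    open ≤-Reasoning
    F = ∑ xs f
    G = ∑ xs g

  -- Induction on the list: each cross term 2 u f(y) is at most u² + f(y)², and over the tail these
  -- bounds add up to exactly what the right side gains besides u².
  cauchySchwarz : (xs : List A) (f : A → ℕ) → ∑ xs f * ∑ xs f ≤ length xs * (∑[ x ∈ xs ] f x * f x)
  cauchySchwarz []       f = z≤n
  cauchySchwarz (x ∷ xs) f = begin
    (u + F) * (u + F)                                    ≡⟨ expand u F ⟩
    u * u + 2 * (u * F) + F * F                          ≤⟨ +-mono-≤ (+-monoʳ-≤ (u * u) cross) (cauchySchwarz xs f) ⟩
    u * u + (length xs * (u * u) + F₂) + length xs * F₂  ≡⟨ collect (u * u) F₂ (length xs) ⟩
    suc (length xs) * (u * u + F₂)                       ∎
    where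
    open ≤-Reasoning
    u  = f x
    F  = ∑ xs f
    F₂ = ∑[ y ∈ xs ] f y * f y
    expand : ∀ u F → (u + F) * (u + F) ≡ u * u + 2 * (u * F) + F * F
    expand = solve-∀
    collect : ∀ v G l → v + (l * v + G) + l * G ≡ suc l * (v + G)
    collect = solve-∀
    cross : 2 * (u * F) ≤ length xs * (u * u) + F₂
    cross = begin
      2 * (u * F)                             ≡⟨ cong (2 *_) (*-distribˡ-∑ u xs f) ⟩
      2 * (∑[ y ∈ xs ] u * f y)               ≡⟨ *-distribˡ-∑ 2 xs _ ⟩
      ∑[ y ∈ xs ] 2 * (u * f y)               ≤⟨ ∑-mono-≤ xs (λ y → 2mn≤m²+n² u (f y)) ⟩
      ∑[ y ∈ xs ] (u * u + f y * f y)         ≡⟨ ∑-distrib-+ xs _ _ ⟩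
      (∑[ _ ∈ xs ] u * u) + F₂                ≡⟨ cong (_+ F₂) (∑-const xs (u * u)) ⟩
      length xs * (u * u) + F₂                ∎

  -- The expander mixing lemma, with the spectral gap replaced by a bound on
  -- the number of common neighbours.
  module Mixing (S : List A) (T U : List B) (K : A → B → ℕ) (P Q R : ℕ) where

    neighbours : B → ℕ
    neighbours t = ∑[ s ∈ S ] K s t

    -- Each s has P neighbours among the P Q elements of U, so `neighbours` has average length S / Q
    -- over U. The distance from this average is scaled by Q to remain a natural number.
    deviation : B → ℕ
    deviation t = ∣ Q * neighbours t - length S ∣

    -- R bounds, for fixed s, the total excess of common neighbours over the average P / Q. When the
    -- square is expanded, the main term `length S * P` of the codegree bound cancels against the
    -- mean and only the excess survives. The cross term is added to both sides to avoid
    -- subtraction.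
    variance : (∀ s → ∑ U (K s) ≡ P) → length U ≡ P * Q →
      (∀ s → Q * (∑[ s′ ∈ S ] ∑[ t ∈ U ] K s t * K s′ t) ≤ length S * P + Q * R) →
      ∑[ t ∈ U ] (deviation t * deviation t) ≤ length S * (Q * Q * R)
    variance degree size codegree = +-cancelʳ-≤ (2 * (Q * (σ * P) * σ)) _ _ (begin
      V + 2 * (Q * (σ * P) * σ)
        ≡⟨ cong (λ z → V + 2 * (Q * z * σ)) ∑neighbours ⟨
      V + 2 * (Q * ∑ U neighbours * σ)
        ≡⟨ cong (V +_) pull ⟩
      V + (∑[ t ∈ U ] 2 * (Q * neighbours t * σ))
        ≡⟨ ∑-distrib-+ U _ _ ⟨
      ∑[ t ∈ U ] (deviation t * deviation t + 2 * (Q * neighbours t * σ))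
        ≡⟨ ∑-cong U (λ t → ∣-∣-square (Q * neighbours t) σ) ⟩
      ∑[ t ∈ U ] (Q * neighbours t * (Q * neighbours t) + σ * σ)
        ≡⟨ ∑-distrib-+ U _ _ ⟩
      (∑[ t ∈ U ] Q * neighbours t * (Q * neighbours t)) + (∑[ _ ∈ U ] σ * σ)
        ≡⟨ cong₂ _+_ squares (trans (∑-const U (σ * σ)) (cong (_* (σ * σ)) size)) ⟩
      Q * (∑[ s ∈ S ] Q * (∑[ s′ ∈ S ] ∑[ t ∈ U ] K s t * K s′ t)) + P * Q * (σ * σ)
        ≤⟨ +-monoˡ-≤ _ (*-monoʳ-≤ Q (∑-mono-≤ S codegree)) ⟩
      Q * (∑[ _ ∈ S ] (σ * P + Q * R)) + P * Q * (σ * σ)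
        ≡⟨ cong (λ z → Q * z + P * Q * (σ * σ)) (∑-const S _) ⟩
      Q * (σ * (σ * P + Q * R)) + P * Q * (σ * σ)
        ≡⟨ collect Q σ P R ⟩
      σ * (Q * Q * R) + 2 * (Q * (σ * P) * σ) ∎)
      where
      open ≤-Reasoning
      σ = length S
      V = ∑[ t ∈ U ] (deviation t * deviation t)

      collect : ∀ Q σ P R → Q * (σ * (σ * P + Q * R)) + P * Q * (σ * σ) ≡
                            σ * (Q * Q * R) + 2 * (Q * (σ * P) * σ)
      collect = solve-∀

      swap : ∀ Q x σ → 2 * (Q * x * σ) ≡ 2 * Q * σ * x
      swap = solve-∀

      square : ∀ Q x → Q * x * (Q * x) ≡ Q * (Q * (x * x))
      square = solve-∀

      ∑neighbours : ∑ U neighbours ≡ σ * P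
      ∑neighbours = trans (∑-comm U S _) (trans (∑-cong S degree) (∑-const S P))

      pull : 2 * (Q * ∑ U neighbours * σ) ≡ ∑[ t ∈ U ] 2 * (Q * neighbours t * σ)
      pull = trans (swap Q _ σ) (trans (*-distribˡ-∑ (2 * Q * σ) U neighbours)
        (∑-cong U λ t → sym (swap Q (neighbours t) σ)))

      pairs : ∀ t → neighbours t * neighbours t ≡ ∑[ s ∈ S ] ∑[ s′ ∈ S ] K s t * K s′ t
      pairs t = trans (*-distribʳ-∑ (neighbours t) S _)
                      (∑-cong S λ s → *-distribˡ-∑ (K s t) S _)

      squares : ∑[ t ∈ U ] Q * neighbours t * (Q * neighbours t) ≡
                Q * (∑[ s ∈ S ] Q * (∑[ s′ ∈ S ] ∑[ t ∈ U ] K s t * K s′ t))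
      squares = begin-equality
        ∑[ t ∈ U ] Q * neighbours t * (Q * neighbours t)
          ≡⟨ ∑-cong U (λ t → square Q (neighbours t)) ⟩
        ∑[ t ∈ U ] Q * (Q * (neighbours t * neighbours t))
          ≡⟨ *-distribˡ-∑ Q U _ ⟨
        Q * (∑[ t ∈ U ] Q * (neighbours t * neighbours t))
          ≡⟨ cong (Q *_) (*-distribˡ-∑ Q U _) ⟨
        Q * (Q * (∑[ t ∈ U ] neighbours t * neighbours t))
          ≡⟨ cong (λ z → Q * (Q * z)) (∑-cong U pairs) ⟩
        Q * (Q * (∑[ t ∈ U ] ∑[ s ∈ S ] ∑[ s′ ∈ S ] K s t * K s′ t))
          ≡⟨ cong (λ z → Q * (Q * z)) (∑-comm U S _) ⟩
        Q * (Q * (∑[ s ∈ S ] ∑[ t ∈ U ] ∑[ s′ ∈ S ] K s t * K s′ t))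
          ≡⟨ cong (λ z → Q * (Q * z)) (∑-cong S λ s → ∑-comm U S _) ⟩
        Q * (Q * (∑[ s ∈ S ] ∑[ s′ ∈ S ] ∑[ t ∈ U ] K s t * K s′ t))
          ≡⟨ cong (Q *_) (*-distribˡ-∑ Q S _) ⟩
        Q * (∑[ s ∈ S ] Q * (∑[ s′ ∈ S ] ∑[ t ∈ U ] K s t * K s′ t)) ∎

    -- Squares being nonnegative, the variance over U dominates the sum over T. The comparison is a
    -- hypothesis because it rests on T being a part of U without repetitions, and B carries no
    -- equality here.
    mixing : (∀ s → ∑ U (K s) ≡ P) → length U ≡ P * Q →
      (∀ s → Q * (∑[ s′ ∈ S ] ∑[ t ∈ U ] K s t * K s′ t) ≤ length S * P + Q * R) →
      ∑[ t ∈ T ] (deviation t * deviation t) ≤ ∑[ t ∈ U ] (deviation t * deviation t) →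
      let D = ∣ Q * (∑[ s ∈ S ] ∑[ t ∈ T ] K s t) - length S * length T ∣ in
      D * D ≤ length S * length T * (Q * Q * R)
    mixing degree size codegree T≤U = begin
      D * D
        ≡⟨ cong (λ z → z * z) (cong₂ ∣_-_∣ count (trans (*-comm _ (length T)) (sym (∑-const T _)))) ⟩
      ∣ ∑[ t ∈ T ] Q * neighbours t - ∑[ _ ∈ T ] length S ∣ * ∣ ∑[ t ∈ T ] Q * neighbours t - ∑[ _ ∈ T ] length S ∣
        ≤⟨ *-mono-≤ (∣∑-∑∣≤∑∣-∣ T _ _) (∣∑-∑∣≤∑∣-∣ T _ _) ⟩
      ∑ T deviation * ∑ T deviation
        ≤⟨ cauchySchwarz T deviation ⟩
      length T * (∑[ t ∈ T ] deviation t * deviation t)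
        ≤⟨ *-monoʳ-≤ (length T) (≤-trans T≤U (variance degree size codegree)) ⟩
      length T * (length S * (Q * Q * R))
        ≡⟨ rearrange (length T) (length S) _ ⟩
      length S * length T * (Q * Q * R) ∎
      where
      open ≤-Reasoning
      D = ∣ Q * (∑[ s ∈ S ] ∑[ t ∈ T ] K s t) - length S * length T ∣
      rearrange : ∀ t s z → t * (s * z) ≡ s * t * z
      rearrange = solve-∀
      count : Q * (∑[ s ∈ S ] ∑[ t ∈ T ] K s t) ≡ ∑[ t ∈ T ] Q * neighbours t
      count = trans (cong (Q *_) (∑-comm S T K)) (*-distribˡ-∑ Q T neighbours)

open Enumeration

-- Linear algebra over a finite field

fieldDecSetoid : ∀ {c ℓ q} → FiniteField c ℓ q → DecSetoid c ℓ
fieldDecSetoid F = record { isDecEquivalence = record { isEquivalence = isEquivalence ; _≟_ = _≟_ } }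
  where open FiniteField F

module LinearAlgebra {c ℓ} {q : ℕ} (F : FiniteField c ℓ q) (d n : ℕ) where
  open FiniteField F hiding (zero)
  open Algebra.Properties.Ring ring using (+-inverseˡ-unique)
  open Algebra.Properties.Semiring.Sum semiring using (sum; sum-cong-≋; sum-replicate-zero; *-distribˡ-sum; *-distribʳ-sum)
    renaming (∑-distrib-+ to sum-distrib-+)
  open import Relation.Binary.Reasoning.Setoid setoid

  private decSetoid = fieldDecSetoid F

  -- The space of dn coordinates, indexed by a block and a position in it. A row of (A₁ ... A_d) and
  -- a column of the stacked B₁ , ... , B_d both live here, and an entry of Σ Aᵢ Bᵢ is their dot
  -- product.
  vectors : DecSetoid c ℓ
  vectors = Pointwise.decSetoid (Pointwise.decSetoid decSetoid n) d

  open DecSetoid vectors using () public renaming (Carrier to V; _≈_ to _≈ⱽ_; _≟_ to _≟ⱽ_)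

  infixl 6 _+ⱽ_
  infixr 7 _·_

  _+ⱽ_ : V → V → V
  (u +ⱽ v) i k = u i k + v i k

  _·_ : Carrier → V → V
  (x · v) i k = x * v i k

  ⟨_,_⟩ : V → V → Carrier
  ⟨ u , v ⟩ = sum λ i → sum λ k → u i k * v i k

  combination : ∀ {r} → Vector Carrier r → Vector V r → V
  combination xs vs i k = sum λ j → xs j * vs j i k

  δ : ∀ {r} → Fin r → Fin r → Carrier
  δ zero    zero    = 1#
  δ zero    (suc j) = 0#
  δ (suc i) zero    = 0#
  δ (suc i) (suc j) = δ i j

  basis : Fin d → Fin n → V
  basis i k i′ k′ = δ i i′ * δ k k′

  sum-zero : ∀ {r} {f : Vector Carrier r} → (∀ i → f i ≈ 0#) → sum f ≈ 0#
  sum-zero {r} f≈0 = trans (sum-cong-≋ f≈0) (sum-replicate-zero r)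

  sum-δ : ∀ {r} (f : Vector Carrier r) i → sum (λ j → f j * δ i j) ≈ f i
  sum-δ f zero = begin
    f zero * 1# + sum (λ j → f (suc j) * 0#)  ≈⟨ +-cong (*-identityʳ (f zero)) (sum-zero λ j → zeroʳ (f (suc j))) ⟩
    f zero + 0#                               ≈⟨ +-identityʳ _ ⟩
    f zero                                    ∎
  sum-δ f (suc i) = begin
    f zero * 0# + sum (λ j → f (suc j) * δ i j)  ≈⟨ +-cong (zeroʳ _) (sum-δ (f ∘ suc) i) ⟩
    0# + f (suc i)                               ≈⟨ +-identityˡ _ ⟩
    f (suc i)                                    ∎

  ⟨⟩-cong : ∀ {u u′ v v′} → u ≈ⱽ u′ → v ≈ⱽ v′ → ⟨ u , v ⟩ ≈ ⟨ u′ , v′ ⟩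
  ⟨⟩-cong u≈u′ v≈v′ = sum-cong-≋ λ i → sum-cong-≋ λ k → *-cong (u≈u′ i k) (v≈v′ i k)

  ⟨⟩-comm : ∀ u v → ⟨ u , v ⟩ ≈ ⟨ v , u ⟩
  ⟨⟩-comm u v = sum-cong-≋ λ i → sum-cong-≋ λ k → *-comm (u i k) (v i k)

  ⟨⟩-distribˡ-+ : ∀ u v w → ⟨ u , v +ⱽ w ⟩ ≈ ⟨ u , v ⟩ + ⟨ u , w ⟩
  ⟨⟩-distribˡ-+ u v w = begin
    ⟨ u , v +ⱽ w ⟩
      ≈⟨ (sum-cong-≋ λ i → sum-cong-≋ λ k → distribˡ (u i k) (v i k) (w i k)) ⟩
    sum (λ i → sum λ k → u i k * v i k + u i k * w i k)
      ≈⟨ (sum-cong-≋ λ i → sum-distrib-+ (λ k → u i k * v i k) (λ k → u i k * w i k)) ⟩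
    sum (λ i → sum (λ k → u i k * v i k) + sum (λ k → u i k * w i k))
      ≈⟨ sum-distrib-+ (λ i → sum (λ k → u i k * v i k)) (λ i → sum (λ k → u i k * w i k)) ⟩
    ⟨ u , v ⟩ + ⟨ u , w ⟩ ∎

  ⟨⟩-distribʳ-+ : ∀ u v w → ⟨ u +ⱽ v , w ⟩ ≈ ⟨ u , w ⟩ + ⟨ v , w ⟩
  ⟨⟩-distribʳ-+ u v w = begin
    ⟨ u +ⱽ v , w ⟩          ≈⟨ ⟨⟩-comm (u +ⱽ v) w ⟩
    ⟨ w , u +ⱽ v ⟩          ≈⟨ ⟨⟩-distribˡ-+ w u v ⟩
    ⟨ w , u ⟩ + ⟨ w , v ⟩   ≈⟨ +-cong (⟨⟩-comm w u) (⟨⟩-comm w v) ⟩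
    ⟨ u , w ⟩ + ⟨ v , w ⟩   ∎

  ⟨⟩-· : ∀ x u v → ⟨ u , x · v ⟩ ≈ x * ⟨ u , v ⟩
  ⟨⟩-· x u v = begin
    ⟨ u , x · v ⟩
      ≈⟨ (sum-cong-≋ λ i → sum-cong-≋ λ k → trans (sym (*-assoc (u i k) x (v i k)))
           (trans (*-congʳ (*-comm (u i k) x)) (*-assoc x (u i k) (v i k)))) ⟩
    sum (λ i → sum λ k → x * (u i k * v i k))
      ≈⟨ (sum-cong-≋ λ i → *-distribˡ-sum x (λ k → u i k * v i k)) ⟨
    sum (λ i → x * sum λ k → u i k * v i k)
      ≈⟨ *-distribˡ-sum x (λ i → sum λ k → u i k * v i k) ⟨
    x * ⟨ u , v ⟩ ∎

  ⟨⟩-combination : ∀ {r} u (xs : Vector Carrier r) vs →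
                   ⟨ u , combination xs vs ⟩ ≈ sum λ j → xs j * ⟨ u , vs j ⟩
  ⟨⟩-combination {zero}  u xs vs = sum-zero λ i → sum-zero λ k → zeroʳ (u i k)
  ⟨⟩-combination {suc r} u xs vs = begin
    ⟨ u , xs zero · vs zero +ⱽ combination (xs ∘ suc) (vs ∘ suc) ⟩
      ≈⟨ ⟨⟩-distribˡ-+ u (xs zero · vs zero) _ ⟩
    ⟨ u , xs zero · vs zero ⟩ + ⟨ u , combination (xs ∘ suc) (vs ∘ suc) ⟩
      ≈⟨ +-cong (⟨⟩-· (xs zero) u (vs zero)) (⟨⟩-combination u (xs ∘ suc) (vs ∘ suc)) ⟩
    sum (λ j → xs j * ⟨ u , vs j ⟩) ∎

  ⟨⟩-basis : ∀ u i k → ⟨ u , basis i k ⟩ ≈ u i k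
  ⟨⟩-basis u i k = begin
    ⟨ u , basis i k ⟩
      ≈⟨ (sum-cong-≋ λ i′ → sum-cong-≋ λ k′ → trans (*-congˡ (*-comm (δ i i′) (δ k k′)))
           (sym (*-assoc (u i′ k′) (δ k k′) (δ i i′)))) ⟩
    sum (λ i′ → sum λ k′ → u i′ k′ * δ k k′ * δ i i′)
      ≈⟨ (sum-cong-≋ λ i′ → *-distribʳ-sum (δ i i′) (λ k′ → u i′ k′ * δ k k′)) ⟨
    sum (λ i′ → sum (λ k′ → u i′ k′ * δ k k′) * δ i i′)
      ≈⟨ (sum-cong-≋ λ i′ → *-congʳ (sum-δ (u i′) k)) ⟩
    sum (λ i′ → u i′ k * δ i i′)
      ≈⟨ sum-δ (λ i′ → u i′ k) i ⟩
    u i k ∎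

  -- Such an X is a right inverse of the matrix with rows R: a certificate of linear independence
  -- that also solves linear systems.
  Dual : ∀ {r} → Vector V r → Set (c ⊔ ℓ)
  Dual {r} R = ∃ λ (X : Vector V r) → ∀ i j → ⟨ R i , X j ⟩ ≈ δ i j

  ≉⇒entry≉ : ∀ {u v : V} → ¬ u ≈ⱽ v → ∃₂ λ i k → u i k ≉ v i k
  ≉⇒entry≉ {u} {v} u≉v with Fin.¬∀⟶∃¬ d _ (λ i → DecSetoid._≟_ (Pointwise.decSetoid decSetoid n) (u i) (v i)) u≉v
  ... | i , uᵢ≉vᵢ with Fin.¬∀⟶∃¬ n _ (λ k → u i k ≟ v i k) uᵢ≉vᵢ
  ...   | k , uᵢₖ≉vᵢₖ = i , k , uᵢₖ≉vᵢₖ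

  -- One step of Gram–Schmidt: either the new row u is a combination of the
  -- rows R, or the coordinate where this fails yields a vector z orthogonal
  -- to R but not to u.
  extendDual : ∀ {r} u (R : Vector V r) → ((X , _) : Dual R) →
               ¬ u ≈ⱽ combination (λ j → ⟨ u , X j ⟩) R → Dual (u Vector.∷ R)
  extendDual {r} u R (X , dual) u≉ = (x₀ Vector.∷ X′) , dual′
    where
    i = proj₁ (≉⇒entry≉ u≉)
    k = proj₁ (proj₂ (≉⇒entry≉ u≉))

    -- By duality ⟨ R l , z ⟩ comes out as R l i k + a l, so these coefficients make z orthogonal to
    -- every row.
    a : Vector Carrier r
    a j = - R j i k

    z : V
    z = basis i k +ⱽ combination a X

    ⟨-,z⟩ : ∀ v → ⟨ v , z ⟩ ≈ v i k + sum (λ j → a j * ⟨ v , X j ⟩)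
    ⟨-,z⟩ v = trans (⟨⟩-distribˡ-+ v (basis i k) (combination a X))
                    (+-cong (⟨⟩-basis v i k) (⟨⟩-combination v a X))

    R⊥z : ∀ l → ⟨ R l , z ⟩ ≈ 0#
    R⊥z l = begin
      ⟨ R l , z ⟩                                     ≈⟨ ⟨-,z⟩ (R l) ⟩
      R l i k + sum (λ j → a j * ⟨ R l , X j ⟩)       ≈⟨ +-congˡ (sum-cong-≋ λ j → *-congˡ (dual l j)) ⟩
      R l i k + sum (λ j → a j * δ l j)               ≈⟨ +-congˡ (sum-δ a l) ⟩
      R l i k + a l                                   ≈⟨ -‿inverseʳ _ ⟩
      0#                                              ∎

    comb = combination (λ j → ⟨ u , X j ⟩) R i k

    comb≈ : comb + sum (λ j → a j * ⟨ u , X j ⟩) ≈ 0#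
    comb≈ = begin
      comb + sum (λ j → a j * ⟨ u , X j ⟩)
        ≈⟨ sum-distrib-+ (λ j → ⟨ u , X j ⟩ * R j i k) (λ j → a j * ⟨ u , X j ⟩) ⟨
      sum (λ j → ⟨ u , X j ⟩ * R j i k + a j * ⟨ u , X j ⟩)
        ≈⟨ (sum-zero λ j → trans (+-congˡ (*-comm (a j) ⟨ u , X j ⟩))
             (trans (sym (distribˡ ⟨ u , X j ⟩ (R j i k) (a j)))
               (trans (*-congˡ (-‿inverseʳ (R j i k))) (zeroʳ ⟨ u , X j ⟩)))) ⟩
      0# ∎

    -- ⟨ u , z ⟩ is the difference between u and the combination at the entry i k, which was chosen
    -- as one where they differ.
    ⟨u,z⟩≉0 : ⟨ u , z ⟩ ≉ 0#
    ⟨u,z⟩≉0 ⟨u,z⟩≈0 = proj₂ (proj₂ (≉⇒entry≉ u≉)) (begin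
      u i k    ≈⟨ +-inverseˡ-unique (u i k) _ (trans (sym (⟨-,z⟩ u)) ⟨u,z⟩≈0) ⟩
      - sum (λ j → a j * ⟨ u , X j ⟩)  ≈⟨ +-inverseˡ-unique comb _ comb≈ ⟨
      comb     ∎)

    α⁻¹ = proj₁ (inverse ⟨ u , z ⟩ ⟨u,z⟩≉0)

    x₀ : V
    x₀ = α⁻¹ · z

    ⟨u,x₀⟩ : ⟨ u , x₀ ⟩ ≈ 1#
    ⟨u,x₀⟩ = trans (⟨⟩-· α⁻¹ u z) (trans (*-comm _ _) (proj₂ (inverse ⟨ u , z ⟩ ⟨u,z⟩≉0)))

    R⊥x₀ : ∀ l → ⟨ R l , x₀ ⟩ ≈ 0#
    R⊥x₀ l = trans (⟨⟩-· α⁻¹ (R l) z) (trans (*-congˡ (R⊥z l)) (zeroʳ _))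

    -- Subtracting ⟨ u , X j ⟩ x₀ makes X j orthogonal to u and keeps its products with R, because
    -- x₀ is orthogonal to R.
    X′ : Vector V r
    X′ j = X j +ⱽ (- ⟨ u , X j ⟩) · x₀

    ⟨-,X′⟩ : ∀ v j → ⟨ v , X′ j ⟩ ≈ ⟨ v , X j ⟩ + (- ⟨ u , X j ⟩) * ⟨ v , x₀ ⟩
    ⟨-,X′⟩ v j = trans (⟨⟩-distribˡ-+ v (X j) _) (+-congˡ (⟨⟩-· (- ⟨ u , X j ⟩) v x₀))

    dual′ : ∀ l j → ⟨ (u Vector.∷ R) l , (x₀ Vector.∷ X′) j ⟩ ≈ δ l j
    dual′ zero    zero    = ⟨u,x₀⟩
    dual′ (suc l) zero    = R⊥x₀ l
    dual′ zero    (suc j) = trans (⟨-,X′⟩ u j)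
      (trans (+-congˡ (trans (*-congˡ ⟨u,x₀⟩) (*-identityʳ _))) (-‿inverseʳ _))
    dual′ (suc l) (suc j) = trans (⟨-,X′⟩ (R l) j)
      (trans (+-cong (dual l j) (trans (*-congˡ (R⊥x₀ l)) (zeroʳ _))) (+-identityʳ _))

  combination-cong : ∀ {r} {xs xs′ : Vector Carrier r} {vs vs′ : Vector V r} →
    (∀ j → xs j ≈ xs′ j) → (∀ j → vs j ≈ⱽ vs′ j) → combination xs vs ≈ⱽ combination xs′ vs′
  combination-cong xs≈ vs≈ i k = sum-cong-≋ λ j → *-cong (xs≈ j) (vs≈ j i k)

-- Counting systems of rows with a linear dependence

module Dependencies {c ℓ} {q : ℕ} (F : FiniteField c ℓ q) (d n : ℕ)
  (U : Enumeration (fieldDecSetoid F)) where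
  open FiniteField F hiding (zero)
  open LinearAlgebra F d n
  private decSetoid = fieldDecSetoid F

  -- Dependences are counted with their coefficients, so that the sum over all
  -- systems of rows has an exact recursion; only positivity matters elsewhere.
  dependencies : ∀ {r} → Vector V r → ℕ
  dependencies {zero}  R = 0
  dependencies {suc r} R =
    (∑[ xs ∈ list (enumeration-Vector U r) ] 𝟙 (R zero ≟ⱽ combination xs (R ∘ suc)))
    ℕ.+ dependencies (R ∘ suc)

  dependencies-cong : ∀ {r} {R R′ : Vector V r} → (∀ j → R j ≈ⱽ R′ j) →
                      dependencies R ≡ dependencies R′
  dependencies-cong {zero}          R≈R′ = ≡.refl
  dependencies-cong {suc r} {R} {R′} R≈R′ = ≡.cong₂ ℕ._+_
    (∑-cong (list (enumeration-Vector U r)) λ xs →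
      𝟙-cong (R zero ≟ⱽ combination xs (R ∘ suc)) (R′ zero ≟ⱽ combination xs (R′ ∘ suc))
        (λ e → V.trans (V.sym (R≈R′ zero)) (V.trans e (combination-cong (λ _ → refl) (R≈R′ ∘ suc))))
        (λ e → V.trans (R≈R′ zero) (V.trans e (V.sym {combination xs (R ∘ suc)} (combination-cong (λ _ → refl) (R≈R′ ∘ suc))))))
    (dependencies-cong (R≈R′ ∘ suc))
    where module V = DecSetoid vectors

  -- Given a dual family X of the later rows, pairing with X j forces the j-th coefficient in any
  -- expression of the first row to be ⟨ R zero , X j ⟩. Testing this one candidate decides the
  -- matter, and its failure is what `extendDual` asks for.
  dependent-or-dual : ∀ {r} (R : Vector V r) → 1 ℕ.≤ dependencies R ⊎ Dual R
  dependent-or-dual {zero}  R = inj₂ ((λ ()) , λ ())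
  dependent-or-dual {suc r} R with dependent-or-dual (R ∘ suc)
  ... | inj₁ 1≤w = inj₁ (ℕ.≤-trans 1≤w (ℕ.m≤n+m _ _))
  ... | inj₂ (X , dual) with R zero ≟ⱽ combination (λ j → ⟨ R zero , X j ⟩) (R ∘ suc)
  -- The list contains `xs` only up to `≈`: `once` supplies the one match, and any coefficients
  -- equal to `xs` give the same combination.
  ...   | yes R₀≈ = inj₁ (ℕ.≤-trans (ℕ.≤-trans (ℕ.≤-reflexive (≡.sym (once Uʳ xs)))
                      (∑-mono-≤ (list Uʳ) λ ys → 𝟙-mono (DecSetoid._≟_ (Pointwise.decSetoid decSetoid r) xs ys)
                        (R zero ≟ⱽ combination ys (R ∘ suc)) λ xs≈ys → V.trans R₀≈
                          (combination-cong {vs = R ∘ suc} {R ∘ suc} xs≈ys λ j → V.refl {R (suc j)}))) (ℕ.m≤m+n _ _))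
    where
    Uʳ = enumeration-Vector U r
    xs = λ j → ⟨ R zero , X j ⟩
    module V = DecSetoid vectors
  ...   | no R₀≉ with extendDual (R zero) (R ∘ suc) (X , dual) R₀≉
  -- `R` agrees with its head put before its tail only pointwise, hence the split on the index.
  ...     | Y , dual′ = inj₂ (Y , λ { zero → dual′ zero ; (suc l) → dual′ (suc l) })

  -- For given later rows and coefficients exactly one first row equals the combination, so the new
  -- summand is the number of choices of later rows and coefficients.
  ∑-dependencies-suc : (Uⱽ : Enumeration vectors) → ∀ r →
    ∑ (list (enumeration-Vector Uⱽ (suc r))) dependencies ≡
    length (list Uⱽ) ^ r ℕ.* length (list U) ^ r
      ℕ.+ length (list Uⱽ) ℕ.* ∑ (list (enumeration-Vector Uⱽ r)) dependencies
  ∑-dependencies-suc Uⱽ r = begin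
    ∑ (list (enumeration-Vector Uⱽ (suc r))) dependencies
      ≡⟨ ∑-cartesianProductWith Vector._∷_ Vs Rs dependencies ⟩
    ∑[ u ∈ Vs ] ∑[ R ∈ Rs ] ((∑[ xs ∈ Xs ] 𝟙 (u ≟ⱽ combination xs R)) ℕ.+ dependencies R)
      ≡⟨ ∑-cong Vs (λ u → ∑-distrib-+ Rs _ dependencies) ⟩
    ∑[ u ∈ Vs ] ((∑[ R ∈ Rs ] ∑[ xs ∈ Xs ] 𝟙 (u ≟ⱽ combination xs R)) ℕ.+ ∑ Rs dependencies)
      ≡⟨ ∑-distrib-+ Vs _ _ ⟩
    (∑[ u ∈ Vs ] ∑[ R ∈ Rs ] ∑[ xs ∈ Xs ] 𝟙 (u ≟ⱽ combination xs R)) ℕ.+ (∑[ _ ∈ Vs ] ∑ Rs dependencies)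
      ≡⟨ ≡.cong₂ ℕ._+_ firstRow (∑-const Vs _) ⟩
    length Vs ^ r ℕ.* length (list U) ^ r ℕ.+ length Vs ℕ.* ∑ Rs dependencies ∎
    where
    open ≡.≡-Reasoning
    Vs = list Uⱽ
    Rs = list (enumeration-Vector Uⱽ r)
    Xs = list (enumeration-Vector U r)
    firstRow : ∑[ u ∈ Vs ] ∑[ R ∈ Rs ] ∑[ xs ∈ Xs ] 𝟙 (u ≟ⱽ combination xs R) ≡
               length Vs ^ r ℕ.* length (list U) ^ r
    firstRow = begin
      ∑[ u ∈ Vs ] ∑[ R ∈ Rs ] ∑[ xs ∈ Xs ] 𝟙 (u ≟ⱽ combination xs R)
        ≡⟨ ∑-comm Vs Rs _ ⟩
      ∑[ R ∈ Rs ] ∑[ u ∈ Vs ] ∑[ xs ∈ Xs ] 𝟙 (u ≟ⱽ combination xs R)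
        ≡⟨ ∑-cong Rs (λ R → ∑-comm Vs Xs _) ⟩
      ∑[ R ∈ Rs ] ∑[ xs ∈ Xs ] ∑[ u ∈ Vs ] 𝟙 (u ≟ⱽ combination xs R)
        ≡⟨ ∑-cong Rs (λ R → ∑-cong Xs λ xs → ≡.trans
             (∑-cong Vs λ u → 𝟙-cong (u ≟ⱽ combination xs R) (combination xs R ≟ⱽ u)
               (λ e i k → sym (e i k)) (λ e i k → sym (e i k)))
             (once Uⱽ (combination xs R))) ⟩
      ∑[ _ ∈ Rs ] ∑[ _ ∈ Xs ] 1
        ≡⟨ ∑-const Rs _ ⟩
      length Rs ℕ.* (∑[ _ ∈ Xs ] 1)
        ≡⟨ ≡.cong₂ ℕ._*_ (length-enumeration-Vector Uⱽ r)
             (≡.trans (≡.sym (length-∑ Xs)) (length-enumeration-Vector U r)) ⟩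
      length Vs ^ r ℕ.* length (list U) ^ r ∎

  -- The dependent row may stand in any of suc r places. With j rows after it, it contributes v ^ r
  -- * x ^ j, where v counts vectors and x scalars; raising j to r gives a bound uniform in the
  -- place. This is the origin of the factor n.
  ∑-dependencies : (Uⱽ : Enumeration vectors) .{{_ : ℕ.NonZero (length (list U))}} → ∀ r →
    ∑ (list (enumeration-Vector Uⱽ (suc r))) dependencies ℕ.≤
    suc r ℕ.* (length (list Uⱽ) ^ r ℕ.* length (list U) ^ r)
  ∑-dependencies Uⱽ zero = ℕ.≤-reflexive (≡.trans (∑-dependencies-suc Uⱽ 0)
    (≡.cong suc (ℕ.*-zeroʳ (length (list Uⱽ)))))
  ∑-dependencies Uⱽ (suc r) = begin
    ∑ (list (enumeration-Vector Uⱽ (2 ℕ.+ r))) dependencies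
      ≡⟨ ∑-dependencies-suc Uⱽ (suc r) ⟩
    v ^ suc r ℕ.* x ^ suc r ℕ.+ v ℕ.* ∑ (list (enumeration-Vector Uⱽ (suc r))) dependencies
      ≤⟨ ℕ.+-monoʳ-≤ _ (ℕ.*-monoʳ-≤ v (∑-dependencies Uⱽ r)) ⟩
    v ^ suc r ℕ.* x ^ suc r ℕ.+ v ℕ.* (suc r ℕ.* (v ^ r ℕ.* x ^ r))
      ≡⟨ ≡.cong (v ^ suc r ℕ.* x ^ suc r ℕ.+_) (rearrange v (suc r) (v ^ r) (x ^ r)) ⟩
    v ^ suc r ℕ.* x ^ suc r ℕ.+ suc r ℕ.* (v ^ suc r ℕ.* x ^ r)
      ≤⟨ ℕ.+-monoʳ-≤ (v ^ suc r ℕ.* x ^ suc r) (ℕ.*-monoʳ-≤ (suc r) (ℕ.*-monoʳ-≤ (v ^ suc r) (ℕ.m≤n*m (x ^ r) x))) ⟩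
    (2 ℕ.+ r) ℕ.* (v ^ suc r ℕ.* x ^ suc r) ∎
    where
    open ℕ.≤-Reasoning
    v = length (list Uⱽ)
    x = length (list U)
    rearrange : ∀ v s y z → v ℕ.* (s ℕ.* (y ℕ.* z)) ≡ s ℕ.* (v ℕ.* y ℕ.* z)
    rearrange = solve-∀

-- Enumeration of the field

∑-allFin-𝟙 : ∀ {n} (i : Fin n) → ∑[ j ∈ allFin n ] 𝟙 (i Fin.≟ j) ≡ 1
∑-allFin-𝟙 {suc n} i = ≡.trans
  (≡.cong (λ js → ∑ (zero ∷ js) λ j → 𝟙 (i Fin.≟ j)) (≡.sym (map-tabulate id suc)))
  (≡.trans (≡.cong (𝟙 (i Fin.≟ zero) ℕ.+_) (∑-map suc (allFin n) _)) (step i))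
  where
  step : ∀ i → 𝟙 (i Fin.≟ zero) ℕ.+ (∑[ j ∈ allFin n ] 𝟙 (i Fin.≟ suc j)) ≡ 1
  step zero    = ≡.cong suc (≡.trans (∑-const (allFin n) 0) (ℕ.*-zeroʳ (length (allFin n))))
  step (suc i) = ≡.trans (∑-cong (allFin n) λ j → 𝟙-cong (suc i Fin.≟ suc j) (i Fin.≟ j)
                           Fin.suc-injective (≡.cong suc))
                         (∑-allFin-𝟙 i)

module _ {c ℓ} {q : ℕ} (F : FiniteField c ℓ q) where
  open FiniteField F

  fieldEnumeration : Enumeration (fieldDecSetoid F)
  fieldEnumeration = record
    { list = map from (allFin q)
    ; once = λ x → ≡.trans (∑-map from (allFin q) _) (≡.trans
        (∑-cong (allFin q) λ j → 𝟙-cong (x ≟ from j) (to x Fin.≟ j) inverseˡ (sym ∘ inverseʳ ∘ ≡.sym))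
        (∑-allFin-𝟙 (to x)))
    }
    where open Inverse enumeration using (to; from; inverseˡ; inverseʳ)

  length-fieldEnumeration : length (list fieldEnumeration) ≡ q
  length-fieldEnumeration = ≡.trans (length-map _ (allFin q)) (length-tabulate id)

-- The map B ↦ A₁ B₁ + ⋯ + A_d B_d

module BlockProduct {c ℓ} {q : ℕ} (F : FiniteField c ℓ q) (d n : ℕ) where
  open FiniteField F hiding (zero)
  open Algebra.Properties.Ring ring using (+-cancelʳ)
  open Algebra.Properties.Group +-group using () renaming (x≈z//y to x+y≈z⇒x≈z-y)
  open Matrices F n
  open LinearAlgebra F d n
  open Algebra.Properties.Semiring.Sum semiring using (sum; sum-cong-≋)
  open import Relation.Binary.Reasoning.Setoid setoid

  matrices : DecSetoid c ℓ
  matrices = Pointwise.decSetoid (Pointwise.decSetoid (fieldDecSetoid F) n) n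

  blocks : DecSetoid c ℓ
  blocks = Pointwise.decSetoid matrices d

  open DecSetoid blocks using () renaming (Carrier to Block; _≈_ to _≈ᴮ_) public

  infixl 7 _∙_
  infixl 6 _+ᴮ_ _-ᴮ_ _-ᴹ_

  _∙_ : Block → Block → Matrix
  A ∙ B = ∑ᴹ (λ i → A i *ᴹ B i)

  _+ᴮ_ _-ᴮ_ : Block → Block → Block
  (A +ᴮ B) i r k = A i r k + B i r k
  (A -ᴮ B) i r k = A i r k - B i r k

  _-ᴹ_ : Matrix → Matrix → Matrix
  (A -ᴹ B) r k = A r k - B r k

  rows : Block → Vector V n
  rows A r i k = A i r k

  column : Block → Fin n → V
  column B s i k = B i k s

  x-y+y≈x : ∀ x y → x - y + y ≈ x
  x-y+y≈x x y = trans (+-assoc x (- y) y) (trans (+-congˡ (-‿inverseˡ y)) (+-identityʳ x))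

  x≈z-y⇒x+y≈z : ∀ {x y z} → x ≈ z - y → x + y ≈ z
  x≈z-y⇒x+y≈z {x} {y} {z} e = trans (+-congʳ e) (x-y+y≈x z y)

  x-y≈z⇒y≈x-z : ∀ {x y z} → x - y ≈ z → y ≈ x - z
  x-y≈z⇒y≈x-z {x} {y} {z} e = x+y≈z⇒x≈z-y y z x (trans (+-comm y z) (x≈z-y⇒x+y≈z (sym e)))

  ∑ᴹ-entry : ∀ {e} (M : Vector Matrix e) r s → ∑ᴹ M r s ≡ sum (λ i → M i r s)
  ∑ᴹ-entry {zero}  M r s = ≡.refl
  ∑ᴹ-entry {suc e} M r s = ≡.cong (M zero r s +_) (∑ᴹ-entry (M ∘ suc) r s)

  ∙-entry : ∀ A B r s → (A ∙ B) r s ≈ ⟨ rows A r , column B s ⟩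
  ∙-entry A B r s = reflexive (∑ᴹ-entry (λ i → A i *ᴹ B i) r s)

  ∙-distribˡ-+ : ∀ A B B′ → A ∙ (B +ᴮ B′) ≈ᴹ A ∙ B +ᴹ A ∙ B′
  ∙-distribˡ-+ A B B′ r s = begin
    (A ∙ (B +ᴮ B′)) r s
      ≈⟨ ∙-entry A (B +ᴮ B′) r s ⟩
    ⟨ rows A r , column B s +ⱽ column B′ s ⟩
      ≈⟨ ⟨⟩-distribˡ-+ (rows A r) (column B s) (column B′ s) ⟩
    ⟨ rows A r , column B s ⟩ + ⟨ rows A r , column B′ s ⟩
      ≈⟨ +-cong (∙-entry A B r s) (∙-entry A B′ r s) ⟨
    (A ∙ B) r s + (A ∙ B′) r s ∎

  -ᴮ-∙ : ∀ A A′ B → (A -ᴮ A′) ∙ B +ᴹ A′ ∙ B ≈ᴹ A ∙ B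
  -ᴮ-∙ A A′ B r s = begin
    ((A -ᴮ A′) ∙ B) r s + (A′ ∙ B) r s
      ≈⟨ +-cong (∙-entry (A -ᴮ A′) B r s) (∙-entry A′ B r s) ⟩
    ⟨ rows (A -ᴮ A′) r , column B s ⟩ + ⟨ rows A′ r , column B s ⟩
      ≈⟨ ⟨⟩-distribʳ-+ (rows (A -ᴮ A′) r) (rows A′ r) (column B s) ⟨
    ⟨ rows (A -ᴮ A′) r +ⱽ rows A′ r , column B s ⟩
      ≈⟨ ⟨⟩-cong (λ i k → x-y+y≈x (A i r k) (A′ i r k)) (λ i k → refl) ⟩
    ⟨ rows A r , column B s ⟩
      ≈⟨ ∙-entry A B r s ⟨
    (A ∙ B) r s ∎

  ∙-cong : ∀ {A A′ B B′} → A ≈ᴮ A′ → B ≈ᴮ B′ → A ∙ B ≈ᴹ A′ ∙ B′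
  ∙-cong {A} {A′} {B} {B′} A≈ B≈ r s = begin
    (A ∙ B) r s                    ≈⟨ ∙-entry A B r s ⟩
    ⟨ rows A r , column B s ⟩      ≈⟨ ⟨⟩-cong (λ i k → A≈ i r k) (λ i k → B≈ i k s) ⟩
    ⟨ rows A′ r , column B′ s ⟩    ≈⟨ ∙-entry A′ B′ r s ⟨
    (A′ ∙ B′) r s                  ∎

  -- Solved column by column: column s of B combines the dual vectors with the entries of column s
  -- of G as coefficients.
  dual⇒surjective : ∀ A → Dual (rows A) → ∀ G → ∃ λ B → A ∙ B ≈ᴹ G
  dual⇒surjective A (X , dual) G = B , λ r s → begin
    (A ∙ B) r s                                  ≈⟨ ∙-entry A B r s ⟩
    ⟨ rows A r , combination (λ j → G j s) X ⟩   ≈⟨ ⟨⟩-combination (rows A r) (λ j → G j s) X ⟩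
    sum (λ j → G j s * ⟨ rows A r , X j ⟩)       ≈⟨ (sum-cong-≋ λ j → *-congˡ (dual r j)) ⟩
    sum (λ j → G j s * δ r j)                    ≈⟨ sum-δ (λ j → G j s) r ⟩
    G r s                                        ∎
    where
    B : Block
    B i k s = combination (λ j → G j s) X i k

  -- The equation of (A , E) determines F as A ∙ B - E; the hypothesis is the equation of (A′ , E′)
  -- with this F inserted.
  commonNeighbour⇒ : ∀ {A A′ B E E′} → A′ ∙ B ≈ᴹ E′ +ᴹ (A ∙ B -ᴹ E) → (A -ᴮ A′) ∙ B ≈ᴹ E -ᴹ E′
  commonNeighbour⇒ {A} {A′} {B} {E} {E′} e r s = x+y≈z⇒x≈z-y _ _ _ (+-cancelʳ p _ _ (begin
    t + e′ + p        ≈⟨ +-congʳ (+-comm t e′) ⟩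
    e′ + t + p        ≈⟨ +-assoc e′ t p ⟩
    e′ + (t + p)      ≈⟨ +-congˡ (-ᴮ-∙ A A′ B r s) ⟩
    e′ + a            ≈⟨ x≈z-y⇒x+y≈z (trans (e r s) (sym (+-assoc e′ a (- E r s)))) ⟨
    p + E r s         ≈⟨ +-comm p (E r s) ⟩
    E r s + p         ∎))
    where
    p = (A′ ∙ B) r s
    t = ((A -ᴮ A′) ∙ B) r s
    a = (A ∙ B) r s
    e′ = E′ r s

  ⇒commonNeighbour : ∀ {A A′ B E E′} → (A -ᴮ A′) ∙ B ≈ᴹ E -ᴹ E′ → A′ ∙ B ≈ᴹ E′ +ᴹ (A ∙ B -ᴹ E)
  ⇒commonNeighbour {A} {A′} {B} {E} {E′} e r s = begin
    p                        ≈⟨ x+y≈z⇒x≈z-y p (E r s) (e′ + a) (begin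
      p + E r s         ≈⟨ +-comm p (E r s) ⟩
      E r s + p         ≈⟨ +-congʳ (x≈z-y⇒x+y≈z (e r s)) ⟨
      t + e′ + p        ≈⟨ +-congʳ (+-comm t e′) ⟩
      e′ + t + p        ≈⟨ +-assoc e′ t p ⟩
      e′ + (t + p)      ≈⟨ +-congˡ (-ᴮ-∙ A A′ B r s) ⟩
      e′ + a            ∎) ⟩
    e′ + a - E r s           ≈⟨ +-assoc e′ a (- E r s) ⟩
    e′ + (a - E r s)         ∎
    where
    p = (A′ ∙ B) r s
    t = ((A -ᴮ A′) ∙ B) r s
    a = (A ∙ B) r s
    e′ = E′ r s

-- Counting solutions

module Counting {c ℓ} {q : ℕ} (F : FiniteField c ℓ q) (d n : ℕ) where
  open FiniteField F using (sym; trans; +-cong; +-congˡ; +-identityˡ; +-comm; ring; +-group; -‿cong)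
  open Algebra.Properties.Ring ring using (+-cancelʳ)
  open Algebra.Properties.Group +-group using () renaming (x≈z//y to x+y≈z⇒x≈z-y)
  open Matrices F n renaming (_≟ᴹ_ to infix 4 _≟ᴹ_)
  open LinearAlgebra F d n using (vectors)
  open Dependencies F d n (fieldEnumeration F)
  open BlockProduct F d n
  private module ᴮ = DecSetoid blocks
  private module ᴹ = DecSetoid matrices

  allVectors : Enumeration vectors
  allVectors = enumeration-Vector (enumeration-Vector (fieldEnumeration F) n) d

  allMatrices : Enumeration matrices
  allMatrices = enumeration-Vector (enumeration-Vector (fieldEnumeration F) n) n

  allBlocks : Enumeration blocks
  allBlocks = enumeration-Vector allMatrices d

  #𝕄 #𝔹 : ℕ
  #𝕄 = length (list allMatrices)
  #𝔹 = length (list allBlocks)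

  fibre : Block → Matrix → ℕ
  fibre D G = ∑[ B ∈ list allBlocks ] 𝟙 (D ∙ B ≟ᴹ G)

  fibre-cong : ∀ {D D′ G G′} → D ≈ᴮ D′ → G ≈ᴹ G′ → fibre D G ≡ fibre D′ G′
  fibre-cong {D} {D′} {G} {G′} D≈ G≈ = ∑-cong (list allBlocks) λ B →
    𝟙-cong (D ∙ B ≟ᴹ G) (D′ ∙ B ≟ᴹ G′)
      (λ e → ᴹ.trans (∙-cong (ᴮ.sym D≈) ᴮ.refl) (ᴹ.trans e G≈))
      (λ e → ᴹ.trans (∙-cong D≈ ᴮ.refl) (ᴹ.trans e (ᴹ.sym G≈)))

  -- A solution B₀ makes the fibre over G a translate of the kernel.
  fibre-translate : ∀ D B₀ {G} → D ∙ B₀ ≈ᴹ G → fibre D G ≡ fibre D 0ᴹ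
  fibre-translate D B₀ {G} DB₀≈G = ≡.trans
    (≡.sym (∑-bijection blocks blocks allBlocks allBlocks {φ = _+ᴮ B₀} {ψ = _-ᴮ B₀}
      (λ B B′ e i r k → x+y≈z⇒x≈z-y _ _ _ (e i r k))
      (λ B B′ e i r k → x≈z-y⇒x+y≈z (e i r k))
      {f = λ B → 𝟙 (D ∙ B ≟ᴹ G)} λ {B} {B′} B≈B′ → 𝟙-cong (D ∙ B ≟ᴹ G) (D ∙ B′ ≟ᴹ G)
        (ᴹ.trans (∙-cong (ᴮ.refl {D}) (ᴮ.sym B≈B′))) (ᴹ.trans (∙-cong (ᴮ.refl {D}) B≈B′))))
    (∑-cong (list allBlocks) λ B → 𝟙-cong (D ∙ (B +ᴮ B₀) ≟ᴹ G) (D ∙ B ≟ᴹ 0ᴹ)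
      (λ e r s → +-cancelʳ (G r s) _ _ (trans (+-congˡ (sym (DB₀≈G r s)))
        (trans (sym (∙-distribˡ-+ D B B₀ r s)) (trans (e r s) (sym (+-identityˡ _))))))
      (λ e r s → trans (∙-distribˡ-+ D B B₀ r s) (trans (+-cong (e r s) (DB₀≈G r s)) (+-identityˡ _))))

  ∑-fibre : ∀ D → ∑ (list allMatrices) (fibre D) ≡ #𝔹
  ∑-fibre D = ≡.trans (∑-comm (list allMatrices) (list allBlocks) _)
    (≡.trans (∑-cong (list allBlocks) λ B → once allMatrices (D ∙ B)) (≡.sym (length-∑ (list allBlocks))))

  ∑-fibre-reflect : ∀ D E → ∑[ E′ ∈ list allMatrices ] fibre D (E -ᴹ E′) ≡ #𝔹
  ∑-fibre-reflect D E = ≡.trans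
    (∑-bijection matrices matrices allMatrices allMatrices {φ = E -ᴹ_} {ψ = E -ᴹ_}
      (λ X Y e r s → x-y≈z⇒y≈x-z (e r s))
      (λ X Y e r s → sym (x-y≈z⇒y≈x-z (sym (e r s))))
      {f = fibre D} (fibre-cong (ᴮ.refl {D})))
    (∑-fibre D)

  -- All fibres of a surjective additive map have the size of its kernel, and the `#𝕄` fibres
  -- together exhaust the `#𝔹` blocks.
  fibre-surjective : ∀ D → (∀ G → ∃ λ B → D ∙ B ≈ᴹ G) → ∀ G → #𝕄 ℕ.* fibre D G ≡ #𝔹
  fibre-surjective D surjective G = begin
    #𝕄 ℕ.* fibre D G                                     ≡⟨ ∑-const (list allMatrices) (fibre D G) ⟨
    ∑[ _ ∈ list allMatrices ] fibre D G                    ≡⟨ ∑-cong (list allMatrices) (λ G′ → ≡.trans (translate G) (≡.sym (translate G′))) ⟩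
    ∑ (list allMatrices) (fibre D)                         ≡⟨ ∑-fibre D ⟩
    #𝔹                                                   ∎
    where
    open ≡.≡-Reasoning
    translate : ∀ G → fibre D G ≡ fibre D 0ᴹ
    translate G = fibre-translate D (proj₁ (surjective G)) (proj₂ (surjective G))

  -- A single inequality that can be summed without splitting cases: independent rows give equality
  -- with the first summand, and a positive number of dependencies makes the second summand alone
  -- large enough.
  fibre-≤ : ∀ D G → #𝕄 ℕ.* fibre D G ℕ.≤ #𝔹 ℕ.+ #𝕄 ℕ.* (dependencies (rows D) ℕ.* fibre D G)
  fibre-≤ D G with dependent-or-dual (rows D)
  ... | inj₁ 1≤w  = ℕ.≤-trans (ℕ.*-monoʳ-≤ #𝕄 (ℕ.≤-trans (ℕ.≤-reflexive (≡.sym (ℕ.*-identityˡ _)))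
                      (ℕ.*-monoˡ-≤ (fibre D G) 1≤w))) (ℕ.m≤n+m _ #𝔹)
  ... | inj₂ dual = ℕ.≤-trans (ℕ.≤-reflexive (fibre-surjective D (dual⇒surjective D dual) G)) (ℕ.m≤m+n _ _)

  -- The bipartite graph: degrees and common neighbours

  K : Block × Matrix → Block × Matrix → ℕ
  K (A , E) (B , F) = 𝟙 (A ∙ B ≟ᴹ E +ᴹ F)

  pairs : DecSetoid _ _
  pairs = ×-decSetoid blocks matrices

  allPairs : Enumeration pairs
  allPairs = enumeration-× allBlocks allMatrices

  #dependencies : ℕ
  #dependencies = ∑ (list (enumeration-Vector allVectors n)) dependencies

  K-≟ : ∀ A B E F → K (A , E) (B , F) ≡ 𝟙 (A ∙ B -ᴹ E ᴹ.≟ F)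
  K-≟ A B E F = 𝟙-cong (A ∙ B ≟ᴹ E +ᴹ F) (A ∙ B -ᴹ E ᴹ.≟ F)
    (λ e r s → sym (x+y≈z⇒x≈z-y (F r s) (E r s) _ (trans (+-comm _ _) (sym (e r s)))))
    (λ e r s → sym (trans (+-comm _ _) (x≈z-y⇒x+y≈z (sym (e r s)))))

  K-cong : ∀ s → Respects≈ pairs (K s)
  K-cong (A , E) {B , F} {B′ , F′} (B≈ , F≈) = 𝟙-cong (A ∙ B ≟ᴹ E +ᴹ F) (A ∙ B′ ≟ᴹ E +ᴹ F′)
    (λ e r s → trans (∙-cong (ᴮ.refl {A}) (ᴮ.sym B≈) r s) (trans (e r s) (+-congˡ (F≈ r s))))
    (λ e r s → trans (∙-cong (ᴮ.refl {A}) B≈ r s) (trans (e r s) (+-congˡ (sym (F≈ r s)))))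

  degree : ∀ s → ∑ (list allPairs) (K s) ≡ #𝔹
  degree (A , E) = begin
    ∑ (list allPairs) (K (A , E))
      ≡⟨ ∑-cartesianProductWith _,_ (list allBlocks) (list allMatrices) _ ⟩
    ∑[ B ∈ list allBlocks ] ∑[ F ∈ list allMatrices ] K (A , E) (B , F)
      ≡⟨ ∑-cong (list allBlocks) (λ B → ≡.trans (∑-cong (list allMatrices) (K-≟ A B E))
           (once allMatrices (A ∙ B -ᴹ E))) ⟩
    ∑[ _ ∈ list allBlocks ] 1
      ≡⟨ length-∑ (list allBlocks) ⟨
    #𝔹 ∎
    where open ≡.≡-Reasoning

  commonNeighbours : ∀ A E A′ E′ →
    ∑[ t ∈ list allPairs ] K (A , E) t ℕ.* K (A′ , E′) t ≡ fibre (A -ᴮ A′) (E -ᴹ E′)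
  commonNeighbours A E A′ E′ = begin
    ∑[ t ∈ list allPairs ] K (A , E) t ℕ.* K (A′ , E′) t
      ≡⟨ ∑-cartesianProductWith _,_ (list allBlocks) (list allMatrices) _ ⟩
    ∑[ B ∈ list allBlocks ] ∑[ F ∈ list allMatrices ] K (A , E) (B , F) ℕ.* K (A′ , E′) (B , F)
      ≡⟨ ∑-cong (list allBlocks) (λ B → ∑-cong (list allMatrices) λ F →
           ≡.cong (ℕ._* K (A′ , E′) (B , F)) (K-≟ A B E F)) ⟩
    ∑[ B ∈ list allBlocks ] ∑[ F ∈ list allMatrices ] 𝟙 (A ∙ B -ᴹ E ᴹ.≟ F) ℕ.* K (A′ , E′) (B , F)
      ≡⟨ ∑-cong (list allBlocks) (λ B → ∑-select matrices allMatrices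
           (λ F≈F′ → K-cong (A′ , E′) (ᴮ.refl {B} , F≈F′)) (A ∙ B -ᴹ E)) ⟩
    ∑[ B ∈ list allBlocks ] K (A′ , E′) (B , A ∙ B -ᴹ E)
      ≡⟨ ∑-cong (list allBlocks) (λ B → 𝟙-cong (A′ ∙ B ≟ᴹ E′ +ᴹ (A ∙ B -ᴹ E)) ((A -ᴮ A′) ∙ B ≟ᴹ E -ᴹ E′)
           (commonNeighbour⇒ {A} {A′} {B} {E} {E′}) (⇒commonNeighbour {A} {A′} {B} {E} {E′})) ⟩
    fibre (A -ᴮ A′) (E -ᴹ E′) ∎
    where open ≡.≡-Reasoning

  -- The error term of `fibre-≤` at the difference of two vertices, without its factor `#𝕄`.
  weight : Block × Matrix → Block × Matrix → ℕ
  weight (A , E) (A′ , E′) = dependencies (rows (A -ᴮ A′)) ℕ.* fibre (A -ᴮ A′) (E -ᴹ E′)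

  weight-cong : ∀ s → Respects≈ pairs (weight s)
  weight-cong (A , E) (A≈ , E≈) = ≡.cong₂ ℕ._*_
    (dependencies-cong λ r i k → +-congˡ (-‿cong (A≈ i r k)))
    (fibre-cong (λ i r k → +-congˡ (-‿cong (A≈ i r k))) (λ r k → +-congˡ (-‿cong (E≈ r k))))

  -- The number of dependencies does not involve E′, so the inner sum runs over all fibres of one
  -- map and equals `#𝔹`. The outer sum then runs over all systems of n rows, since A′ ↦ A - A′ is a
  -- bijection.
  ∑-weight : ∀ s → ∑ (list allPairs) (weight s) ≡ #dependencies ℕ.* #𝔹
  ∑-weight (A , E) = begin
    ∑ (list allPairs) (weight (A , E))
      ≡⟨ ∑-cartesianProductWith _,_ (list allBlocks) (list allMatrices) _ ⟩
    ∑[ A′ ∈ list allBlocks ] ∑[ E′ ∈ list allMatrices ] dependencies (rows (A -ᴮ A′)) ℕ.* fibre (A -ᴮ A′) (E -ᴹ E′)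
      ≡⟨ ∑-cong (list allBlocks) (λ A′ → ≡.trans
           (≡.sym (*-distribˡ-∑ (dependencies (rows (A -ᴮ A′))) (list allMatrices) _))
           (≡.cong (dependencies (rows (A -ᴮ A′)) ℕ.*_) (∑-fibre-reflect (A -ᴮ A′) E))) ⟩
    ∑[ A′ ∈ list allBlocks ] dependencies (rows (A -ᴮ A′)) ℕ.* #𝔹
      ≡⟨ *-distribʳ-∑ #𝔹 (list allBlocks) _ ⟨
    (∑[ A′ ∈ list allBlocks ] dependencies (rows (A -ᴮ A′))) ℕ.* #𝔹
      ≡⟨ ≡.cong (ℕ._* #𝔹) (∑-bijection blocks (Pointwise.decSetoid vectors n) allBlocks (enumeration-Vector allVectors n)
           {φ = λ A′ → rows (A -ᴮ A′)} {ψ = λ R i r k → FiniteField._-_ F (A i r k) (R r i k)}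
           (λ A′ R e i r k → x-y≈z⇒y≈x-z (e r i k)) (λ A′ R e r i k → sym (x-y≈z⇒y≈x-z (sym (e i r k))))
           {f = dependencies} dependencies-cong) ⟩
    #dependencies ℕ.* #𝔹 ∎
    where
    open ≡.≡-Reasoning

  codegree : (S : List (Block × Matrix)) → (∀ s → multiplicity pairs s S ℕ.≤ 1) → ∀ s →
    #𝕄 ℕ.* (∑[ s′ ∈ S ] ∑[ t ∈ list allPairs ] K s t ℕ.* K s′ t) ℕ.≤
    length S ℕ.* #𝔹 ℕ.+ #𝕄 ℕ.* (#dependencies ℕ.* #𝔹)
  codegree S S≤1 s@(A , E) = begin
    #𝕄 ℕ.* (∑[ s′ ∈ S ] ∑[ t ∈ list allPairs ] K s t ℕ.* K s′ t)
      ≡⟨ ≡.cong (#𝕄 ℕ.*_) (∑-cong S λ (A′ , E′) → commonNeighbours A E A′ E′) ⟩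
    #𝕄 ℕ.* (∑[ s′ ∈ S ] fibre (A -ᴮ proj₁ s′) (E -ᴹ proj₂ s′))
      ≡⟨ *-distribˡ-∑ #𝕄 S _ ⟩
    ∑[ s′ ∈ S ] #𝕄 ℕ.* fibre (A -ᴮ proj₁ s′) (E -ᴹ proj₂ s′)
      ≤⟨ ∑-mono-≤ S (λ (A′ , E′) → fibre-≤ (A -ᴮ A′) (E -ᴹ E′)) ⟩
    ∑[ s′ ∈ S ] (#𝔹 ℕ.+ #𝕄 ℕ.* weight s s′)
      ≡⟨ ∑-distrib-+ S _ _ ⟩
    (∑[ _ ∈ S ] #𝔹) ℕ.+ (∑[ s′ ∈ S ] #𝕄 ℕ.* weight s s′)
      ≡⟨ ≡.cong₂ ℕ._+_ (∑-const S #𝔹) (≡.sym (*-distribˡ-∑ #𝕄 S _)) ⟩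
    length S ℕ.* #𝔹 ℕ.+ #𝕄 ℕ.* ∑ S (weight s)
      -- Only the error term is enlarged from S to all pairs; the main term must keep its factor
      -- `length S` to cancel in the variance.
      ≤⟨ ℕ.+-monoʳ-≤ (length S ℕ.* #𝔹) (ℕ.*-monoʳ-≤ #𝕄
           (∑-≤-enumeration pairs allPairs S S≤1 (weight-cong s))) ⟩
    length S ℕ.* #𝔹 ℕ.+ #𝕄 ℕ.* ∑ (list allPairs) (weight s)
      ≡⟨ ≡.cong (λ z → length S ℕ.* #𝔹 ℕ.+ #𝕄 ℕ.* z) (∑-weight s) ⟩
    length S ℕ.* #𝔹 ℕ.+ #𝕄 ℕ.* (#dependencies ℕ.* #𝔹) ∎
    where open ℕ.≤-Reasoning

  blockPairs : Vector MatrixSet d → MatrixSet → List (Block × Matrix)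
  blockPairs 𝒜 ℰ = cartesianProduct (choices (λ i → elements (𝒜 i))) (elements ℰ)

  blockPairs-unique : ∀ 𝒜 ℰ s → multiplicity pairs s (blockPairs 𝒜 ℰ) ℕ.≤ 1
  blockPairs-unique 𝒜 ℰ (A , E) = ℕ.≤-trans
    (ℕ.≤-reflexive (multiplicity-× blocks matrices A E (choices (λ i → elements (𝒜 i))) (elements ℰ)))
    (ℕ.*-mono-≤
      (ℕ.≤-trans (ℕ.≤-reflexive (multiplicity-choices matrices A (λ i → elements (𝒜 i))))
        (∏-≤1 λ i → unique⇒multiplicity≤1 matrices (FiniteSubset.unique (𝒜 i)) (A i)))
      (unique⇒multiplicity≤1 matrices (FiniteSubset.unique ℰ) E))

  solutionCount-∑ : ∀ 𝒜 ℬ ℰ ℱ → solutionCount 𝒜 ℬ ℰ ℱ ≡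
    ∑[ s ∈ blockPairs 𝒜 ℰ ] ∑[ t ∈ blockPairs ℬ ℱ ] K s t
  solutionCount-∑ 𝒜 ℬ ℰ ℱ = begin
    solutionCount 𝒜 ℬ ℰ ℱ
      ≡⟨ length-filter isSolution? (tuples 𝒜 ℬ ℰ ℱ) ⟩
    ∑[ x ∈ tuples 𝒜 ℬ ℰ ℱ ] 𝟙 (isSolution? x)
      ≡⟨ ∑-cartesianProductWith _,_ As _ _ ⟩
    ∑[ A ∈ As ] ∑[ x ∈ cartesianProduct Bs (cartesianProduct Es Fs) ] 𝟙 (isSolution? (A , x))
      ≡⟨ ∑-cong As (λ A → ∑-cartesianProductWith _,_ Bs _ _) ⟩
    ∑[ A ∈ As ] ∑[ B ∈ Bs ] ∑[ x ∈ cartesianProduct Es Fs ] 𝟙 (isSolution? (A , B , x))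
      ≡⟨ ∑-cong As (λ A → ∑-cong Bs λ B → ∑-cartesianProductWith _,_ Es Fs _) ⟩
    ∑[ A ∈ As ] ∑[ B ∈ Bs ] ∑[ E ∈ Es ] ∑[ F ∈ Fs ] K (A , E) (B , F)
      ≡⟨ ∑-cong As (λ A → ∑-comm Bs Es _) ⟩
    ∑[ A ∈ As ] ∑[ E ∈ Es ] ∑[ B ∈ Bs ] ∑[ F ∈ Fs ] K (A , E) (B , F)
      ≡⟨ ∑-cong As (λ A → ∑-cong Es λ E → ∑-cartesianProductWith _,_ Bs Fs _) ⟨
    ∑[ A ∈ As ] ∑[ E ∈ Es ] ∑[ t ∈ blockPairs ℬ ℱ ] K (A , E) t
      ≡⟨ ∑-cartesianProductWith _,_ As Es _ ⟨
    ∑[ s ∈ blockPairs 𝒜 ℰ ] ∑[ t ∈ blockPairs ℬ ℱ ] K s t ∎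
    where
    open ≡.≡-Reasoning
    As = choices (λ i → elements (𝒜 i))
    Bs = choices (λ i → elements (ℬ i))
    Es = elements ℰ
    Fs = elements ℱ

  sizeProduct-length : ∀ 𝒜 ℬ ℰ ℱ → sizeProduct 𝒜 ℬ ℰ ℱ ≡
                       length (blockPairs 𝒜 ℰ) ℕ.* length (blockPairs ℬ ℱ)
  sizeProduct-length 𝒜 ℬ ℰ ℱ = begin
    ∣ ℰ ∣ ℕ.* ∣ ℱ ∣ ℕ.* ∏ (λ i → ∣ 𝒜 i ∣ ℕ.* ∣ ℬ i ∣)
      ≡⟨ ≡.cong (∣ ℰ ∣ ℕ.* ∣ ℱ ∣ ℕ.*_) (∏-distrib-* (λ i → ∣ 𝒜 i ∣) (λ i → ∣ ℬ i ∣)) ⟩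
    ∣ ℰ ∣ ℕ.* ∣ ℱ ∣ ℕ.* (∏ (λ i → ∣ 𝒜 i ∣) ℕ.* ∏ (λ i → ∣ ℬ i ∣))
      ≡⟨ rearrange ∣ ℰ ∣ ∣ ℱ ∣ (∏ (λ i → ∣ 𝒜 i ∣)) (∏ (λ i → ∣ ℬ i ∣)) ⟩
    ∏ (λ i → ∣ 𝒜 i ∣) ℕ.* ∣ ℰ ∣ ℕ.* (∏ (λ i → ∣ ℬ i ∣) ℕ.* ∣ ℱ ∣)
      ≡⟨ ≡.cong₂ ℕ._*_ (length-blockPairs 𝒜 ℰ) (length-blockPairs ℬ ℱ) ⟨
    length (blockPairs 𝒜 ℰ) ℕ.* length (blockPairs ℬ ℱ) ∎
    where
    open ≡.≡-Reasoning
    rearrange : ∀ e f a b → e ℕ.* f ℕ.* (a ℕ.* b) ≡ a ℕ.* e ℕ.* (b ℕ.* f)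
    rearrange = solve-∀
    length-blockPairs : ∀ 𝒜 ℰ → length (blockPairs 𝒜 ℰ) ≡ ∏ (λ i → ∣ 𝒜 i ∣) ℕ.* ∣ ℰ ∣
    length-blockPairs 𝒜 ℰ = ≡.trans (length-cartesianProductWith _,_ (choices (λ i → elements (𝒜 i))) (elements ℰ))
      (≡.cong (ℕ._* ∣ ℰ ∣) (length-choices (λ i → elements (𝒜 i))))

  solutionCount-deviation : ∀ 𝒜 ℬ ℰ ℱ →
    let X = sizeProduct 𝒜 ℬ ℰ ℱ
        D = ℕ.∣ #𝕄 ℕ.* solutionCount 𝒜 ℬ ℰ ℱ - X ∣
    in D ℕ.* D ℕ.≤ X ℕ.* (#𝕄 ℕ.* #𝕄 ℕ.* (#dependencies ℕ.* #𝔹))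
  solutionCount-deviation 𝒜 ℬ ℰ ℱ
    rewrite solutionCount-∑ 𝒜 ℬ ℰ ℱ | sizeProduct-length 𝒜 ℬ ℰ ℱ =
    mixing degree (length-cartesianProductWith _,_ (list allBlocks) (list allMatrices))
      (codegree (blockPairs 𝒜 ℰ) (blockPairs-unique 𝒜 ℰ))
      (∑-≤-enumeration pairs allPairs (blockPairs ℬ ℱ) (blockPairs-unique ℬ ℱ)
        λ {t} {t′} t≈t′ → ≡.cong (λ k → ∣-∣² (#𝕄 ℕ.* k))
          (∑-cong (blockPairs 𝒜 ℰ) λ s → K-cong s t≈t′))
    where
    open Mixing (blockPairs 𝒜 ℰ) (blockPairs ℬ ℱ) (list allPairs) K #𝔹 #𝕄 (#dependencies ℕ.* #𝔹)
    ∣-∣² : ℕ → ℕ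
    ∣-∣² m = ℕ.∣ m - length (blockPairs 𝒜 ℰ) ∣ ℕ.* ℕ.∣ m - length (blockPairs 𝒜 ℰ) ∣

-- Transfer to ℚ

open import Data.Integer.Base using (+_)

toℚᵘ-ℕ→ℚ : ∀ m → ℚ.toℚᵘ (ℕ→ℚ m) ≃ mkℚᵘ (+ m) 0
toℚᵘ-ℕ→ℚ m = ℚ.toℚᵘ-fromℚᵘ (mkℚᵘ (+ m) 0)

ℕ→ℚ-homo-+ : ∀ m n → ℕ→ℚ (m ℕ.+ n) ≡ ℕ→ℚ m ℚ.+ ℕ→ℚ n
ℕ→ℚ-homo-+ m n = ℚ.toℚᵘ-injective (begin
  ℚ.toℚᵘ (ℕ→ℚ (m ℕ.+ n))                       ≈⟨ toℚᵘ-ℕ→ℚ (m ℕ.+ n) ⟩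
  mkℚᵘ (+ (m ℕ.+ n)) 0                          ≈⟨ *≡* (≡.cong (λ z → (z ℤ.* (+ 1))) (≡.sym (≡.cong₂ ℤ._+_ (ℤ.*-identityʳ (+ m)) (ℤ.*-identityʳ (+ n))))) ⟩
  mkℚᵘ (+ m) 0 ℚᵘ.+ mkℚᵘ (+ n) 0                ≈⟨ ℚᵘ.+-cong (toℚᵘ-ℕ→ℚ m) (toℚᵘ-ℕ→ℚ n) ⟨
  ℚ.toℚᵘ (ℕ→ℚ m) ℚᵘ.+ ℚ.toℚᵘ (ℕ→ℚ n)            ≈⟨ ℚ.toℚᵘ-homo-+ (ℕ→ℚ m) (ℕ→ℚ n) ⟨
  ℚ.toℚᵘ (ℕ→ℚ m ℚ.+ ℕ→ℚ n)                      ∎)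
  where open ℚᵘ.≃-Reasoning

ℕ→ℚ-homo-* : ∀ m n → ℕ→ℚ (m ℕ.* n) ≡ ℕ→ℚ m ℚ.* ℕ→ℚ n
ℕ→ℚ-homo-* m n = ℚ.toℚᵘ-injective (begin
  ℚ.toℚᵘ (ℕ→ℚ (m ℕ.* n))                       ≈⟨ toℚᵘ-ℕ→ℚ (m ℕ.* n) ⟩
  mkℚᵘ (+ (m ℕ.* n)) 0                          ≈⟨ *≡* (≡.cong (λ z → (z ℤ.* (+ 1))) (ℤ.pos-* m n)) ⟩
  mkℚᵘ (+ m) 0 ℚᵘ.* mkℚᵘ (+ n) 0                ≈⟨ ℚᵘ.*-cong (toℚᵘ-ℕ→ℚ m) (toℚᵘ-ℕ→ℚ n) ⟨
  ℚ.toℚᵘ (ℕ→ℚ m) ℚᵘ.* ℚ.toℚᵘ (ℕ→ℚ n)            ≈⟨ ℚ.toℚᵘ-homo-* (ℕ→ℚ m) (ℕ→ℚ n) ⟨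
  ℚ.toℚᵘ (ℕ→ℚ m ℚ.* ℕ→ℚ n)                      ∎)
  where open ℚᵘ.≃-Reasoning

ℕ→ℚ-mono-≤ : ∀ {m n} → m ℕ.≤ n → ℕ→ℚ m ℚ.≤ ℕ→ℚ n
ℕ→ℚ-mono-≤ {m} {n} m≤n = ℚ.toℚᵘ-cancel-≤ (begin
  ℚ.toℚᵘ (ℕ→ℚ m)  ≃⟨ toℚᵘ-ℕ→ℚ m ⟩
  mkℚᵘ (+ m) 0    ≤⟨ *≤* (ℤ.*-monoʳ-≤-nonNeg (+ 1) (ℤ.+≤+ m≤n)) ⟩
  mkℚᵘ (+ n) 0    ≃⟨ toℚᵘ-ℕ→ℚ n ⟨
  ℚ.toℚᵘ (ℕ→ℚ n)  ∎)
  where open ℚᵘ.≤-Reasoning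

ℕ→ℚ-pos : ∀ m .{{_ : ℕ.NonZero m}} → ℚ.Positive (ℕ→ℚ m)
ℕ→ℚ-pos m = ℚ.normalize-pos m 1

∣ℕ→ℚ∣ : ∀ m → ℚ.∣ ℕ→ℚ m ∣ ≡ ℕ→ℚ m
∣ℕ→ℚ∣ m = ℚ.0≤p⇒∣p∣≡p (ℕ→ℚ-mono-≤ {n = m} z≤n)

/-*-cancel : ∀ m n .{{_ : ℕ.NonZero n}} → (+ m ℚ./ n) ℚ.* ℕ→ℚ n ≡ ℕ→ℚ m
/-*-cancel m n@(suc k) = ℚ.toℚᵘ-injective (begin
  ℚ.toℚᵘ ((+ m ℚ./ n) ℚ.* ℕ→ℚ n)            ≈⟨ ℚ.toℚᵘ-homo-* (+ m ℚ./ n) (ℕ→ℚ n) ⟩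
  ℚ.toℚᵘ (+ m ℚ./ n) ℚᵘ.* ℚ.toℚᵘ (ℕ→ℚ n)    ≈⟨ ℚᵘ.*-cong (ℚ.toℚᵘ-fromℚᵘ (mkℚᵘ (+ m) k)) (toℚᵘ-ℕ→ℚ n) ⟩
  mkℚᵘ (+ m) k ℚᵘ.* mkℚᵘ (+ n) 0            ≈⟨ *≡* (ℤ.*-assoc (+ m) (+ n) (+ 1)) ⟩
  mkℚᵘ (+ m) 0                              ≈⟨ toℚᵘ-ℕ→ℚ m ⟨
  ℚ.toℚᵘ (ℕ→ℚ m)                            ∎)
  where open ℚᵘ.≃-Reasoning

∣ℕ→ℚ-ℕ→ℚ∣-≤ : ∀ {m n} → m ℕ.≤ n → ℚ.∣ ℕ→ℚ n ℚ.- ℕ→ℚ m ∣ ≡ ℕ→ℚ (n ℕ.∸ m)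
∣ℕ→ℚ-ℕ→ℚ∣-≤ {m} {n} m≤n = begin
  ℚ.∣ ℕ→ℚ n ℚ.- ℕ→ℚ m ∣                               ≡⟨ ≡.cong (λ z → ℚ.∣ ℕ→ℚ z ℚ.- ℕ→ℚ m ∣) (ℕ.m∸n+n≡m m≤n) ⟨
  ℚ.∣ ℕ→ℚ (n ℕ.∸ m ℕ.+ m) ℚ.- ℕ→ℚ m ∣                 ≡⟨ ≡.cong (λ z → ℚ.∣ z ℚ.- ℕ→ℚ m ∣) (ℕ→ℚ-homo-+ (n ℕ.∸ m) m) ⟩
  ℚ.∣ ℕ→ℚ (n ℕ.∸ m) ℚ.+ ℕ→ℚ m ℚ.- ℕ→ℚ m ∣             ≡⟨ ≡.cong ℚ.∣_∣ (ℚ.+-assoc (ℕ→ℚ (n ℕ.∸ m)) (ℕ→ℚ m) _) ⟩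
  ℚ.∣ ℕ→ℚ (n ℕ.∸ m) ℚ.+ (ℕ→ℚ m ℚ.- ℕ→ℚ m) ∣           ≡⟨ ≡.cong (λ z → ℚ.∣ ℕ→ℚ (n ℕ.∸ m) ℚ.+ z ∣) (ℚ.+-inverseʳ (ℕ→ℚ m)) ⟩
  ℚ.∣ ℕ→ℚ (n ℕ.∸ m) ℚ.+ ℚ.0ℚ ∣                        ≡⟨ ≡.cong ℚ.∣_∣ (ℚ.+-identityʳ (ℕ→ℚ (n ℕ.∸ m))) ⟩
  ℚ.∣ ℕ→ℚ (n ℕ.∸ m) ∣                                 ≡⟨ ∣ℕ→ℚ∣ (n ℕ.∸ m) ⟩
  ℕ→ℚ (n ℕ.∸ m)                                       ∎
  where open ≡.≡-Reasoning

∣p-q∣≡∣q-p∣ : ∀ p q → ℚ.∣ p ℚ.- q ∣ ≡ ℚ.∣ q ℚ.- p ∣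
∣p-q∣≡∣q-p∣ p q = begin
  ℚ.∣ p ℚ.- q ∣             ≡⟨ ℚ.∣-p∣≡∣p∣ (p ℚ.- q) ⟨
  ℚ.∣ ℚ.- (p ℚ.- q) ∣       ≡⟨ ≡.cong ℚ.∣_∣ (⁻¹-anti-homo‿- p q) ⟩
  ℚ.∣ q ℚ.- p ∣             ∎
  where
  open ≡.≡-Reasoning
  open import Algebra.Properties.AbelianGroup ℚ.+-0-abelianGroup using (⁻¹-anti-homo‿-)

∣ℕ→ℚ-ℕ→ℚ∣ : ∀ m n → ℚ.∣ ℕ→ℚ m ℚ.- ℕ→ℚ n ∣ ≡ ℕ→ℚ ℕ.∣ m - n ∣
∣ℕ→ℚ-ℕ→ℚ∣ m n with ℕ.≤-total m n
... | inj₁ m≤n = ≡.trans (∣p-q∣≡∣q-p∣ (ℕ→ℚ m) (ℕ→ℚ n))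
                   (≡.trans (∣ℕ→ℚ-ℕ→ℚ∣-≤ m≤n) (≡.cong ℕ→ℚ (≡.sym (ℕ.m≤n⇒∣m-n∣≡n∸m m≤n))))
... | inj₂ n≤m = ≡.trans (∣ℕ→ℚ-ℕ→ℚ∣-≤ n≤m) (≡.cong ℕ→ℚ (≡.sym (ℕ.m≤n⇒∣n-m∣≡n∸m n≤m)))

∣-/∣-* : ∀ N X Q .{{_ : ℕ.NonZero Q}} →
         ℚ.∣ ℕ→ℚ N ℚ.- + X ℚ./ Q ∣ ℚ.* ℕ→ℚ Q ≡ ℕ→ℚ ℕ.∣ Q ℕ.* N - X ∣
∣-/∣-* N X Q = begin
  ℚ.∣ a ∣ ℚ.* ℕ→ℚ Q                          ≡⟨ ≡.cong (ℚ.∣ a ∣ ℚ.*_) (∣ℕ→ℚ∣ Q) ⟨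
  ℚ.∣ a ∣ ℚ.* ℚ.∣ ℕ→ℚ Q ∣                    ≡⟨ ℚ.∣p*q∣≡∣p∣*∣q∣ a (ℕ→ℚ Q) ⟨
  ℚ.∣ a ℚ.* ℕ→ℚ Q ∣                          ≡⟨ ≡.cong ℚ.∣_∣ ([y-z]x≈yx-zx (ℕ→ℚ Q) (ℕ→ℚ N) (+ X ℚ./ Q)) ⟩
  ℚ.∣ ℕ→ℚ N ℚ.* ℕ→ℚ Q ℚ.- (+ X ℚ./ Q) ℚ.* ℕ→ℚ Q ∣
    ≡⟨ ≡.cong₂ (λ y z → ℚ.∣ y ℚ.- z ∣) (≡.trans (≡.sym (ℕ→ℚ-homo-* N Q)) (≡.cong ℕ→ℚ (ℕ.*-comm N Q))) (/-*-cancel X Q) ⟩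
  ℚ.∣ ℕ→ℚ (Q ℕ.* N) ℚ.- ℕ→ℚ X ∣              ≡⟨ ∣ℕ→ℚ-ℕ→ℚ∣ (Q ℕ.* N) X ⟩
  ℕ→ℚ ℕ.∣ Q ℕ.* N - X ∣                      ∎
  where
  open ≡.≡-Reasoning
  open import Algebra.Properties.Ring ℚ.+-*-ring using ([y-z]x≈yx-zx)
  a = ℕ→ℚ N ℚ.- + X ℚ./ Q

-- Multiplying the squared inequality by Q² clears the denominator of X / Q and leaves a comparison
-- of natural numbers.
≤·√-intro : ∀ N X Q C Y .{{_ : ℕ.NonZero Q}} → let D = ℕ.∣ Q ℕ.* N - X ∣ in
  D ℕ.* D ℕ.≤ C ℕ.* C ℕ.* Y ℕ.* (Q ℕ.* Q) → ℚ.∣ ℕ→ℚ N ℚ.- + X ℚ./ Q ∣ ≤ ℕ→ℚ C ·√ Y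
≤·√-intro N X Q C Y D²≤ = ℚ.*-cancelʳ-≤-pos (ℕ→ℚ (Q ℕ.* Q)) (begin
  a ℚ.* a ℚ.* ℕ→ℚ (Q ℕ.* Q)                    ≡⟨ ≡.cong (a ℚ.* a ℚ.*_) (ℕ→ℚ-homo-* Q Q) ⟩
  a ℚ.* a ℚ.* (ℕ→ℚ Q ℚ.* ℕ→ℚ Q)                ≡⟨ interchange a a (ℕ→ℚ Q) (ℕ→ℚ Q) ⟩
  a ℚ.* ℕ→ℚ Q ℚ.* (a ℚ.* ℕ→ℚ Q)                ≡⟨ ≡.cong (λ z → z ℚ.* z) (∣-/∣-* N X Q) ⟩
  ℕ→ℚ D ℚ.* ℕ→ℚ D                              ≡⟨ ℕ→ℚ-homo-* D D ⟨
  ℕ→ℚ (D ℕ.* D)                                ≤⟨ ℕ→ℚ-mono-≤ D²≤ ⟩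
  ℕ→ℚ (C ℕ.* C ℕ.* Y ℕ.* (Q ℕ.* Q))            ≡⟨ ℕ→ℚ-homo-* (C ℕ.* C ℕ.* Y) (Q ℕ.* Q) ⟩
  ℕ→ℚ (C ℕ.* C ℕ.* Y) ℚ.* ℕ→ℚ (Q ℕ.* Q)        ≡⟨ ≡.cong (ℚ._* ℕ→ℚ (Q ℕ.* Q)) (≡.trans (ℕ→ℚ-homo-* (C ℕ.* C) Y)
                                                    (≡.cong (ℚ._* ℕ→ℚ Y) (ℕ→ℚ-homo-* C C))) ⟩
  ℕ→ℚ C ℚ.* ℕ→ℚ C ℚ.* ℕ→ℚ Y ℚ.* ℕ→ℚ (Q ℕ.* Q)  ∎)
  where
  open ℚ.≤-Reasoning
  open import Algebra.Properties.CommutativeSemigroup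
    (CommutativeMonoid.commutativeSemigroup ℚ.*-1-commutativeMonoid) using (interchange)
  a = ℚ.∣ ℕ→ℚ N ℚ.- + X ℚ./ Q ∣
  D = ℕ.∣ Q ℕ.* N - X ∣
  instance
    Q²-pos : ℚ.Positive (ℕ→ℚ (Q ℕ.* Q))
    Q²-pos = ℕ→ℚ-pos (Q ℕ.* Q) {{ℕ.m*n≢0 Q Q}}

-- Powers of q and the constant

doubledExponent-sum : ∀ d n →
  suc n ℕ.* suc d ℕ.* n ℕ.+ n ℕ.+ suc n ℕ.* suc n ℕ.* suc d ≡ doubledExponent (suc d) (suc n)
-- With both dimensions written as successors, the subtracted number is a literal summand of the
-- minuend, so truncated subtraction just removes it. What remains adds the exponents of the bound
-- for `#dependencies` and of `#𝔹`.
doubledExponent-sum d n = ≡.sym (≡.trans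
  (≡.cong (ℕ._∸ (d ℕ.* suc n ℕ.+ 1)) (lemma d n))
  (ℕ.m+n∸n≡m _ (d ℕ.* suc n ℕ.+ 1)))
  where
  lemma : ∀ d n → 2 ℕ.* suc d ℕ.* (suc n ℕ.* suc n) ≡
    suc n ℕ.* suc d ℕ.* n ℕ.+ n ℕ.+ suc n ℕ.* suc n ℕ.* suc d ℕ.+ (d ℕ.* suc n ℕ.+ 1)
  lemma = solve-∀

solutionCount-bound : ∀ {c ℓ} d′ n′ q .{{_ : ℕ.NonZero q}} (F : FiniteField c ℓ q) →
  let d = suc d′
      n = suc n′
      Q = q ^ (n ℕ.* n)
      open Matrices F n
  in
  (𝒜 ℬ : Vector MatrixSet d) (ℰ ℱ : MatrixSet) →
  let N = solutionCount 𝒜 ℬ ℰ ℱ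
      X = sizeProduct 𝒜 ℬ ℰ ℱ
      D = ℕ.∣ Q ℕ.* N - X ∣
  in D ℕ.* D ℕ.≤ n ℕ.* n ℕ.* (q ^ doubledExponent d n ℕ.* X) ℕ.* (Q ℕ.* Q)
solutionCount-bound d′ n′ q F 𝒜 ℬ ℰ ℱ = begin
  ℕ.∣ Q ℕ.* N - X ∣ ℕ.* ℕ.∣ Q ℕ.* N - X ∣
    ≡⟨ ≡.cong (λ Q → ℕ.∣ Q ℕ.* N - X ∣ ℕ.* ℕ.∣ Q ℕ.* N - X ∣) #𝕄≡ ⟨
  ℕ.∣ #𝕄 ℕ.* N - X ∣ ℕ.* ℕ.∣ #𝕄 ℕ.* N - X ∣
    ≤⟨ solutionCount-deviation 𝒜 ℬ ℰ ℱ ⟩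
  X ℕ.* (#𝕄 ℕ.* #𝕄 ℕ.* (#dependencies ℕ.* #𝔹))
    ≡⟨ ≡.cong (λ Q → X ℕ.* (Q ℕ.* Q ℕ.* (#dependencies ℕ.* #𝔹))) #𝕄≡ ⟩
  X ℕ.* (Q ℕ.* Q ℕ.* (#dependencies ℕ.* #𝔹))
    ≤⟨ ℕ.*-monoʳ-≤ X (ℕ.*-monoʳ-≤ (Q ℕ.* Q) #dependencies*#𝔹≤) ⟩
  X ℕ.* (Q ℕ.* Q ℕ.* (n ℕ.* n ℕ.* q ^ e))
    ≡⟨ rearrange X (Q ℕ.* Q) (n ℕ.* n) (q ^ e) ⟩
  n ℕ.* n ℕ.* (q ^ e ℕ.* X) ℕ.* (Q ℕ.* Q) ∎
  where
  open ℕ.≤-Reasoning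
  d = suc d′
  n = suc n′
  open Matrices F n
  open Counting F d n
  N = solutionCount 𝒜 ℬ ℰ ℱ
  X = sizeProduct 𝒜 ℬ ℰ ℱ
  Q = q ^ (n ℕ.* n)
  e = doubledExponent d n
  𝔽 = fieldEnumeration F
  #𝔽 = length (list 𝔽)

  rearrange : ∀ X Q n q → X ℕ.* (Q ℕ.* (n ℕ.* q)) ≡ n ℕ.* (q ℕ.* X) ℕ.* Q
  rearrange = solve-∀

  #𝔽≡ : #𝔽 ≡ q
  #𝔽≡ = length-fieldEnumeration F

  length-arrays : ∀ k l → length (list (enumeration-Vector (enumeration-Vector 𝔽 k) l)) ≡ q ^ (k ℕ.* l)
  length-arrays k l = ≡.trans (length-enumeration-Vector (enumeration-Vector 𝔽 k) l)
    (≡.trans (≡.cong (_^ l) (≡.trans (length-enumeration-Vector 𝔽 k) (≡.cong (_^ k) #𝔽≡)))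
      (ℕ.^-*-assoc q k l))

  #𝕄≡ : #𝕄 ≡ Q
  #𝕄≡ = length-arrays n n

  #𝔹≡ : #𝔹 ≡ q ^ (n ℕ.* n ℕ.* d)
  #𝔹≡ = ≡.trans (length-enumeration-Vector allMatrices d)
    (≡.trans (≡.cong (_^ d) #𝕄≡) (ℕ.^-*-assoc q (n ℕ.* n) d))

  instance
    #𝔽≢0 : ℕ.NonZero #𝔽
    #𝔽≢0 = ℕ.≢-nonZero λ #𝔽≡0 → ℕ.≢-nonZero⁻¹ q (≡.trans (≡.sym #𝔽≡) #𝔽≡0)

  #dependencies≤ : #dependencies ℕ.≤ n ℕ.* q ^ (n ℕ.* d ℕ.* n′ ℕ.+ n′)
  #dependencies≤ = begin
    #dependencies
      ≤⟨ Dependencies.∑-dependencies F d n 𝔽 allVectors n′ ⟩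
    n ℕ.* (length (list allVectors) ^ n′ ℕ.* #𝔽 ^ n′)
      ≡⟨ ≡.cong (n ℕ.*_) (≡.cong₂ (λ v x → v ^ n′ ℕ.* x ^ n′) (length-arrays n d) #𝔽≡) ⟩
    n ℕ.* ((q ^ (n ℕ.* d)) ^ n′ ℕ.* q ^ n′)
      ≡⟨ ≡.cong (λ z → n ℕ.* (z ℕ.* q ^ n′)) (ℕ.^-*-assoc q (n ℕ.* d) n′) ⟩
    n ℕ.* (q ^ (n ℕ.* d ℕ.* n′) ℕ.* q ^ n′)
      ≡⟨ ≡.cong (n ℕ.*_) (ℕ.^-distribˡ-+-* q (n ℕ.* d ℕ.* n′) n′) ⟨
    n ℕ.* q ^ (n ℕ.* d ℕ.* n′ ℕ.+ n′) ∎

  #dependencies*#𝔹≤ : #dependencies ℕ.* #𝔹 ℕ.≤ n ℕ.* n ℕ.* q ^ e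
  #dependencies*#𝔹≤ = begin
    #dependencies ℕ.* #𝔹
      ≤⟨ ℕ.*-monoˡ-≤ #𝔹 #dependencies≤ ⟩
    n ℕ.* q ^ (n ℕ.* d ℕ.* n′ ℕ.+ n′) ℕ.* #𝔹
      ≡⟨ ≡.cong (n ℕ.* q ^ (n ℕ.* d ℕ.* n′ ℕ.+ n′) ℕ.*_) #𝔹≡ ⟩
    n ℕ.* q ^ (n ℕ.* d ℕ.* n′ ℕ.+ n′) ℕ.* q ^ (n ℕ.* n ℕ.* d)
      ≡⟨ ℕ.*-assoc n (q ^ (n ℕ.* d ℕ.* n′ ℕ.+ n′)) (q ^ (n ℕ.* n ℕ.* d)) ⟩
    n ℕ.* (q ^ (n ℕ.* d ℕ.* n′ ℕ.+ n′) ℕ.* q ^ (n ℕ.* n ℕ.* d))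
      ≡⟨ ≡.cong (n ℕ.*_) (≡.trans (≡.sym (ℕ.^-distribˡ-+-* q (n ℕ.* d ℕ.* n′ ℕ.+ n′) (n ℕ.* n ℕ.* d)))
           (≡.cong (q ^_) (doubledExponent-sum d′ n′))) ⟩
    n ℕ.* q ^ e
      -- The factor n is weakened to n², the square of the rational constant C = n.
      ≤⟨ ℕ.*-monoˡ-≤ (q ^ e) (ℕ.m≤m*n n n) ⟩
    n ℕ.* n ℕ.* q ^ e ∎

theorem1p2 : (d n : ℕ) → 1 ℕ.≤ d → 2 ℕ.≤ n →
    ∃ λ (C : ℚ) → ℚ.Positive C ×
    ((q : ℕ) (q-opp : OddPrimePower q) (F : FiniteField 0ℓ 0ℓ q) →
    let open Matrices F n in
    (𝒜 ℬ : Vector MatrixSet d) (ℰ ℱ : MatrixSet) →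
    let N = solutionCount 𝒜 ℬ ℰ ℱ
        X = sizeProduct 𝒜 ℬ ℰ ℱ
        main = ℚ._/_ (+ X) (q ℕ.^ (n ℕ.* n)) {{primePower^m≢0 q-opp (n ℕ.* n)}}
    in ℚ.∣ ℕ→ℚ N ℚ.- main ∣ ≤ C ·√ (q ℕ.^ doubledExponent d n ℕ.* X))
theorem1p2 (suc d′) n@(suc n′) _ _ = ℕ→ℚ n , ℕ→ℚ-pos n , λ q q-opp F 𝒜 ℬ ℰ ℱ →
  let instance
        q≢0 : ℕ.NonZero q
        -- `q ^ 1` computes to `q * 1`.
        q≢0 = ≡.subst ℕ.NonZero (ℕ.*-identityʳ q) (primePower^m≢0 q-opp 1)
  in ≤·√-intro (Matrices.solutionCount F n 𝒜 ℬ ℰ ℱ) (Matrices.sizeProduct F n 𝒜 ℬ ℰ ℱ)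
       (q ^ (n ℕ.* n)) n (q ^ doubledExponent (suc d′) n ℕ.* Matrices.sizeProduct F n 𝒜 ℬ ℰ ℱ)
       {{primePower^m≢0 q-opp (n ℕ.* n)}}
       (solutionCount-bound d′ n′ q F 𝒜 ℬ ℰ ℱ)
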